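{- Let $S$ be a language whose symbol set is countable, let $X$ be a set of formulas of $S$ and let $\varphi$ be a formula of $S$. If $X \models \varphi$, then $X \vdash_{D_1} \varphi$, where $D_1 = \{R_0, R_{=}, R_{\leftrightarrow}, R_{\Rightarrow}, R_{+}, R_{\mathcal{R}}, R_{\exists\rightarrow}, R_{\downarrow}, R_{\exists\leftarrow}, R_c, R_{\cup}, R_{\neg\neg}\}$.
   Context: Strings: for a set $A$, $A^*$ is the set of finite tuples (strings) over $A$; concatenation is written by juxtaposition and a symbol is identified with the one-letter string. A language $S$ consists of an integer-valued function $\#$ (the arity), an element $\equiv\ \in \operatorname{dom}\#$ with $\#(\equiv)=-2$, and an object $\downarrow\ \notin \operatorname{dom}\#$, such that the set of literals $\{s\in\operatorname{dom}\#:\#(s)=0\}$ is infinite; the symbol set of $S$ is $\operatorname{dom}\#\cup\{\downarrow\}$. Terms of $S$: the smallest set of strings containing the one-letter string $v$ for each literal $v$ and containing $s\,t_1\cdots t_n$ whenever $\#(s)=n>0$ and $t_1,\dots,t_n$ are terms. Formulas: the smallest set containing the atomic formulas $r\,t_1\cdots t_n$ with $\#(r)=-n<0$ and $t_i$ terms, containing $\downarrow\varphi\psi$ for formulas $\varphi,\psi$ (NOR), and containing $v\varphi$ for a literal $v$ and formula $\varphi$ (read "there exists $v$ with $\varphi$"). Write $\neg\varphi$ for $\downarrow\varphi\varphi$. Simple substitution $\psi[v_1/v_2]$ replaces every occurrence of the literal $v_1$ in the string $\psi$ by the literal $v_2$. Term substitution $\psi[v:=t]$ ($v$ literal, $t$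 term): in an atomic formula, every occurrence of $v$ inside its argument terms is replaced by $t$; $(\downarrow\varphi\psi)[v:=t]=\downarrow\varphi[v:=t]\,\psi[v:=t]$; $(v_1\varphi)[v:=t]=v'\,(\varphi[v_1/v'])[v:=t]$ for some literal $v'$ not equal to $v$ and not occurring in $t$ or $\varphi$. Semantics: an interpretation $i$ with universe a nonempty set $U$ assigns to each $s\in\operatorname{dom}\#$ a map $U^{\#(s)}\to U$ if $\#(s)\ge 0$ (for a literal, an element of $U$) and a map $U^{ -\#(s)}\to\{0,1\}$ if $\#(s)<0$. Terms are evaluated by $i(s\,t_1\cdots t_n)=i(s)(i(t_1),\dots,i(t_n))$; an atomic formula $r\,t_1\cdots t_n$ with $r\ne\ \equiv$ evaluates to $i(r)(i(t_1),\dots,i(t_n))$, and $\equiv t_1t_2$ evaluates to $1$ iff $i(t_1)=i(t_2)$; $\downarrow\varphi\psi$ evaluates to $1$ iff both $\varphi,\psi$ evaluate to $0$; $v\varphi$ evaluates to $1$ iff there is $u\in U$ such that $\varphi$ evaluates to $1$ under $i[v\mapsto u]$ (the interpretation equal to $i$ except that it assigns $u$ to $v$). $i\models X$ means every formula in $X$ evaluates to $1$; $X\models\varphi$ means every interpretation of $S$ satisfying $X$ gives $\varphi$ value $1$. Proof theory: a sequent is a pair $(\Gamma,\varphi)$ with $\Gamma$ a finite set of formulas and $\varphi$ a formula. A rule is any map from sets of sequents to sets of sequents; a ruleset is a set of rules. For a ruleset $D$ let $O_D(\Sigma)=\bigcup_{R\in D}R(\Sigma)$ and $O_D^n$ its $n$-th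 iterate ($O_D^0$ the identity). $X\vdash_D\varphi$ iff there are $n\in\mathbb N$ and a finite $\Gamma\subseteq X$ with $(\Gamma,\varphi)\in O_D^n(\emptyset)$. The rules (for $\Sigma$ a set of sequents; $t,t_j,t'_j$ terms, $\varphi,\varphi_j,\psi$ formulas, $v,v_1,v_2$ literals): $R_0(\Sigma)=\{(\{\varphi\},\varphi)\}$; $R_\cup(\Sigma)=\{(\Gamma,\varphi):\exists(\Gamma',\varphi)\in\Sigma,\ \Gamma'\subseteq\Gamma\}$; $R_=(\Sigma)=\{(\emptyset,\equiv tt)\}$; $R_\leftrightarrow(\Sigma)=\{(\{\equiv t_1t_2\},\equiv t_2t_1)\}$; $R_\Rightarrow(\Sigma)=\{(\{\equiv t_1t_2,\equiv t_2t_3\},\equiv t_1t_3)\}$; $R_+(\Sigma)=\{(\{\equiv t_jt'_j:1\le j\le n\},\ \equiv s t_1\cdots t_n\, s t'_1\cdots t'_n):\#(s)=n>0\}$; $R_{\mathcal R}(\Sigma)=\{(\{\equiv t_jt'_j:1\le j\le n\}\cup\{r t_1\cdots t_n\},\ r t'_1\cdots t'_n):\#(r)=-n<0\}$; $R_\downarrow(\Sigma)=\{(\{\downarrow\varphi_1\varphi_2,\downarrow\varphi_3\varphi_4\},\downarrow\varphi_2\varphi_3)\}$; $R_{\exists\rightarrow}(\Sigma)=\{(\{\psi[v:=t]\},v\psi)\}$; $R_{\exists\leftarrow}(\Sigma)=\{(\Gamma'\setminus\{\psi[v_1/v_2]\}\cup\{v_1\psi\},\ \neg{\equiv vv}): (\Gamma'\cup\{\psi[v_1/v_2]\},\neg{\equiv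 vv})\in\Sigma,\ v_2$ occurs in no element of $\Gamma'\cup\{\psi\}\}$; $R_c(\Sigma)=\{(\Gamma,\neg\varphi):\exists\psi,\ (\Gamma\cup\{\varphi\},\psi),(\Gamma\cup\{\varphi\},\neg\psi)\in\Sigma\}$; $R_{\neg\neg}(\Sigma)=\{(\Gamma,\varphi):(\Gamma,\neg\neg\varphi)\in\Sigma\}$. -}

module Defs where


open import Data.Nat using (ℕ; zero; suc)
open import Data.Integer using (ℤ; +_; -[1+_])
open import Data.Bool using (Bool; true; false; T)
open import Data.List using (List; []; _∷_; _++_; [_])
open import Data.List.Membership.Propositional using (_∈_; _∉_)
open import Data.Vec using (Vec; []; _∷_; lookup)
open import Data.Fin using (Fin)
open import Data.Product using (Σ; _×_; _,_; ∃; ∃-syntax)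
open import Data.Sum using (_⊎_; inj₁; inj₂)
open import Data.Empty using (⊥)
open import Relation.Nullary using (¬_; Dec; yes; no)
open import Relation.Binary using (DecidableEquality)
open import Relation.Binary.PropositionalEquality using (_≡_; _≢_; refl; subst) renaming (sym to ≡-sym)
open import Function.Definitions using (Injective)

-- Languages
--   Sym      : dom #            (the symbols with an arity)
--   ar       : the arity function #
--   eqs      : the symbol ≡, with #(≡) = -2
--   ↓ is a new letter added in 'Letter' below, so ↓ ∉ dom # automatically.
--   _≟_      : decidable equality of symbols (meta-level; implied by
--              the countability hypothesis of the theorem)
--   lits-inf : the set of literals {s | #(s) = 0} is infinite
--              (no finite list contains all literals)

record Language : Set₁ where
  field
    Sym      : Set
    ar       : Sym → ℤ
    eqs      : Sym
    ar-eqs   : ar eqs ≡ -[1+ 1 ]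
    _≟_      : DecidableEquality Sym
    lits-inf : (l : List Sym) → Σ Sym (λ s → (ar s ≡ + 0) × (s ∉ l))

Countable : Language → Set
Countable L = Σ (Sym → ℕ) (λ f → Injective _≡_ _≡_ f)
  where open Language L

module _ (L : Language) where
  open Language L

  data Letter : Set where
    sym : Sym → Letter
    ↓   : Letter

  Word : Set
  Word = List Letter

  IsLiteral : Sym → Set
  IsLiteral s = ar s ≡ + 0

  concatV : ∀ {n} → Vec Word n → Word
  concatV []       = []
  concatV (w ∷ ws) = w ++ concatV ws

  -- Terms (n = 0 is the literal case, n > 0 the application case)
  mutual
    data Term : Word → Set where
      app : ∀ {s n} → ar s ≡ + n → {ts : Vec Word n} → Terms ts →
            Term (sym s ∷ concatV ts)

    data Terms : ∀ {n} → Vec Word n → Set where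
      []  : Terms []
      _∷_ : ∀ {n t} {ts : Vec Word n} → Term t → Terms ts → Terms (t ∷ ts)

  data Formula : Word → Set where
    atom : ∀ {r n} → ar r ≡ -[1+ n ] → {ts : Vec Word (suc n)} → Terms ts →
           Formula (sym r ∷ concatV ts)
    nor  : ∀ {φ ψ} → Formula φ → Formula ψ → Formula (↓ ∷ φ ++ ψ)
    ex   : ∀ {v φ} → IsLiteral v → Formula φ → Formula (sym v ∷ φ)

  eqW : Word → Word → Word
  eqW t₁ t₂ = sym eqs ∷ t₁ ++ t₂

  norW : Word → Word → Word
  norW φ ψ = ↓ ∷ φ ++ ψ

  negW : Word → Word
  negW φ = norW φ φ

  Occurs : Sym → Word → Set
  Occurs v w = sym v ∈ w

  substL : Sym → Sym → Letter → Letter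
  substL v₁ v₂ ↓ = ↓
  substL v₁ v₂ (sym s) with s ≟ v₁
  ... | yes _ = sym v₂
  ... | no  _ = sym s

  _[_/_] : Word → Sym → Sym → Word
  []      [ v₁ / v₂ ] = []
  (a ∷ w) [ v₁ / v₂ ] = substL v₁ v₂ a ∷ (w [ v₁ / v₂ ])

  replace : Sym → Word → Word → Word
  replace v t []            = []
  replace v t (↓ ∷ w)       = ↓ ∷ replace v t w
  replace v t (sym s ∷ w) with s ≟ v
  ... | yes _ = t ++ replace v t w
  ... | no  _ = sym s ∷ replace v t w

  -- Term substitution ψ[v := t]; since the renaming literal v' may be
  -- any admissible literal, this is a relation  TSub v t ψ χ  ("χ is a
  -- value of ψ[v:=t]").
  data TSub (v : Sym) (t : Word) : Word → Word → Set where
    atomT : ∀ {r n} → ar r ≡ -[1+ n ] → {ts : Vec Word (suc n)} → Terms ts →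
            TSub v t (sym r ∷ concatV ts) (sym r ∷ replace v t (concatV ts))
    norT  : ∀ {φ ψ φ' ψ'} → Formula φ → Formula ψ →
            TSub v t φ φ' → TSub v t ψ ψ' →
            TSub v t (norW φ ψ) (norW φ' ψ')
    exT   : ∀ {v₁ v' φ χ} → IsLiteral v₁ → Formula φ →
            IsLiteral v' → v' ≢ v → ¬ Occurs v' t → ¬ Occurs v' φ →
            TSub v t (φ [ v₁ / v' ]) χ →
            TSub v t (sym v₁ ∷ φ) (sym v' ∷ χ)

  Den : Set → ℤ → Set
  Den U (+ n)     = Vec U n → U
  Den U -[1+ n ]  = Vec U (suc n) → Bool

  record Interp : Set₁ where
    field
      U   : Set
      u₀  : U
      int : (s : Sym) → Den U (ar s)

  open Interp

  update : (i : Interp) (v : Sym) → IsLiteral v → U i → Interp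
  U   (update i v p u) = U i
  u₀  (update i v p u) = u₀ i
  int (update i v p u) s with s ≟ v
  ... | yes refl = subst (Den (U i)) (≡-sym p) (λ _ → u)
  ... | no  _    = int i s

  mutual
    evalT : (i : Interp) → ∀ {t} → Term t → U i
    evalT i (app {s} p ts) = subst (Den (U i)) p (int i s) (evalTs i ts)

    evalTs : (i : Interp) → ∀ {n} {ts : Vec Word n} → Terms ts → Vec (U i) n
    evalTs i []       = []
    evalTs i (d ∷ ds) = evalT i d ∷ evalTs i ds

  -- value of ≡ t₁ t₂ (only the case n = 1 arises, since #(≡) = -2)
  eqVal : ∀ {A : Set} (n : ℕ) → Vec A (suc n) → Set
  eqVal 1 (a ∷ b ∷ []) = a ≡ b
  eqVal _ _            = ⊥

  Sat : (i : Interp) → ∀ {φ} → Formula φ → Set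
  Sat i (atom {r} {n} p ts) with r ≟ eqs
  ... | yes _ = eqVal n (evalTs i ts)
  ... | no  _ = T (subst (Den (U i)) p (int i r) (evalTs i ts))
  Sat i (nor d e)  = ¬ Sat i d × ¬ Sat i e
  Sat i (ex {v} p d) = Σ (U i) (λ u → Sat (update i v p u) d)

  Holds : Interp → Word → Set
  Holds i φ = Σ (Formula φ) (Sat i)

  _⊨ˢ_ : Interp → (Word → Set) → Set
  i ⊨ˢ X = ∀ x → X x → Holds i x

  _⊨_ : (Word → Set) → Word → Set₁
  X ⊨ φ = ∀ (i : Interp) → i ⊨ˢ X → Holds i φ

  -- Proof theory.
  -- A sequent is (Γ , φ) with Γ a finite set of formulas, represented by
  -- a list; all rules below depend on Γ only through its set of members.
  Seq : Set
  Seq = List Word × Word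

  _≐_ : List Word → (Word → Set) → Set
  Γ ≐ P = ∀ x → (x ∈ Γ → P x) × (P x → x ∈ Γ)

  _⊆ˡ_ : List Word → List Word → Set
  Γ ⊆ˡ Δ = ∀ x → x ∈ Γ → x ∈ Δ

  data AllF : List Word → Set where
    []  : AllF []
    _∷_ : ∀ {φ Γ} → Formula φ → AllF Γ → AllF (φ ∷ Γ)

  SeqSet : Set₁
  SeqSet = Seq → Set

  Rule : Set₁
  Rule = SeqSet → SeqSet

  R₀ : Rule
  R₀ Σ' (Γ , φ) = Formula φ × Γ ≐ (_≡ φ)

  R∪ : Rule
  R∪ Σ' (Γ , φ) = AllF Γ × ∃[ Γ' ] (Σ' (Γ' , φ) × Γ' ⊆ˡ Γ)

  R₌ : Rule
  R₌ Σ' (Γ , φ) = Γ ≐ (λ _ → ⊥) × ∃[ t ] (Term t × φ ≡ eqW t t)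

  R↔ : Rule
  R↔ Σ' (Γ , φ) = ∃[ t₁ ] ∃[ t₂ ] (Term t₁ × Term t₂ ×
                   Γ ≐ (_≡ eqW t₁ t₂) × φ ≡ eqW t₂ t₁)

  R⇒ : Rule
  R⇒ Σ' (Γ , φ) = ∃[ t₁ ] ∃[ t₂ ] ∃[ t₃ ] (Term t₁ × Term t₂ × Term t₃ ×
                   Γ ≐ (λ x → x ≡ eqW t₁ t₂ ⊎ x ≡ eqW t₂ t₃) × φ ≡ eqW t₁ t₃)

  R₊ : Rule
  R₊ Σ' (Γ , φ) = ∃[ s ] ∃[ n ] Σ (Vec Word (suc n)) λ ts → Σ (Vec Word (suc n)) λ ts' →
                   ar s ≡ + suc n × Terms ts × Terms ts' ×
                   Γ ≐ (λ x → ∃[ j ] (x ≡ eqW (lookup ts j) (lookup ts' j))) ×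
                   φ ≡ eqW (sym s ∷ concatV ts) (sym s ∷ concatV ts')

  R𝓡 : Rule
  R𝓡 Σ' (Γ , φ) = ∃[ r ] ∃[ n ] Σ (Vec Word (suc n)) λ ts → Σ (Vec Word (suc n)) λ ts' →
                   ar r ≡ -[1+ n ] × Terms ts × Terms ts' ×
                   Γ ≐ (λ x → ∃[ j ] (x ≡ eqW (lookup ts j) (lookup ts' j))
                              ⊎ x ≡ sym r ∷ concatV ts) ×
                   φ ≡ sym r ∷ concatV ts'

  R↓ : Rule
  R↓ Σ' (Γ , φ) = ∃[ φ₁ ] ∃[ φ₂ ] ∃[ φ₃ ] ∃[ φ₄ ]
                   (Formula φ₁ × Formula φ₂ × Formula φ₃ × Formula φ₄ ×
                    Γ ≐ (λ x → x ≡ norW φ₁ φ₂ ⊎ x ≡ norW φ₃ φ₄) ×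
                    φ ≡ norW φ₂ φ₃)

  R∃→ : Rule
  R∃→ Σ' (Γ , φ) = ∃[ ψ ] ∃[ v ] ∃[ t ] ∃[ χ ]
                    (Formula ψ × IsLiteral v × Term t × TSub v t ψ χ ×
                     Γ ≐ (_≡ χ) × φ ≡ sym v ∷ ψ)

  R∃← : Rule
  R∃← Σ' (Γ , φ) = ∃[ Γ' ] ∃[ Δ ] ∃[ ψ ] ∃[ v ] ∃[ v₁ ] ∃[ v₂ ]
                    (AllF Γ' × Formula ψ ×
                     IsLiteral v × IsLiteral v₁ × IsLiteral v₂ ×
                     Σ' (Δ , negW (eqW [ sym v ] [ sym v ])) ×
                     Δ ≐ (λ x → x ∈ Γ' ⊎ x ≡ ψ [ v₁ / v₂ ]) ×
                     (∀ x → x ∈ Γ' → ¬ Occurs v₂ x) × ¬ Occurs v₂ ψ ×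
                     Γ ≐ (λ x → (x ∈ Γ' × x ≢ ψ [ v₁ / v₂ ]) ⊎ x ≡ sym v₁ ∷ ψ) ×
                     φ ≡ negW (eqW [ sym v ] [ sym v ]))

  R꜀ : Rule
  R꜀ Σ' (Γ , φ) = ∃[ φ₀ ] ∃[ ψ ] ∃[ Δ₁ ] ∃[ Δ₂ ]
                   (φ ≡ negW φ₀ ×
                    Δ₁ ≐ (λ x → x ∈ Γ ⊎ x ≡ φ₀) × Δ₂ ≐ (λ x → x ∈ Γ ⊎ x ≡ φ₀) ×
                    Σ' (Δ₁ , ψ) × Σ' (Δ₂ , negW ψ))

  R¬¬ : Rule
  R¬¬ Σ' (Γ , φ) = Σ' (Γ , negW (negW φ))

  O : List Rule → Rule
  O []      Σ' s = ⊥
  O (R ∷ D) Σ' s = R Σ' s ⊎ O D Σ' s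

  iter : ℕ → Rule → Rule
  iter zero    F Σ' = Σ'
  iter (suc n) F Σ' = F (iter n F Σ')

  ∅ˢ : SeqSet
  ∅ˢ _ = ⊥

  _⊢[_]_ : (Word → Set) → List Rule → Word → Set
  X ⊢[ D ] φ = ∃[ n ] ∃[ Γ ] ((∀ x → x ∈ Γ → X x) × iter n (O D) ∅ˢ (Γ , φ))

  D₁ : List Rule
  D₁ = R₀ ∷ R₌ ∷ R↔ ∷ R⇒ ∷ R₊ ∷ R𝓡 ∷ R∃→ ∷ R↓ ∷ R∃← ∷ R꜀ ∷ R∪ ∷ R¬¬ ∷ []

{-# OPTIONS --safe #-}
module Submission where

-- Suppose φ is not derivable from X. A map σ sending the literals injectively
-- to the even members of a sequence of distinct literals frees infinitely many
-- literals, and a finite permutation of the literals undoes σ on any finite set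
-- of formulas; as derivability is invariant under such permutations, the
-- σ-image Y of X ∪ {¬φ} is still consistent. Henkin's construction extends Y to
-- a maximal consistent theory in which the freed literals witness the
-- existential formulas, and its term model M satisfies exactly the formulas of
-- that theory. Composing M with σ gives a model of X in which φ fails.

open import Defs
open import Relation.Nullary using (Dec; yes; no; ¬_)
open import Relation.Nullary.Decidable using (True; ⌊_⌋; toWitness; fromWitness)
open import Data.Nat using (ℕ; zero; suc; _+_; _*_; _≤_; _<_; _⊔_; s≤s)
open import Data.Nat.Properties
  using (≤-refl; ≤-trans; ≤-antisym; ≤-pred; m≤m⊔n; m≤n⊔m; m≤n⇒m<n∨m≡n; ≮⇒≥; <-cmp; 1+n≰n; *-cancelˡ-≡; even≢odd; suc-injective; +-comm)
open import Data.Integer using (+_; -[1+_])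
import Data.Integer.Properties as Int
open import Data.Integer.Properties using (+-injective; -[1+-injective)
open import Data.Bool using (T)
open import Data.Bool.Properties using (T-irrelevant)
open import Data.Fin using (Fin)
open import Data.List using (List; []; _∷_; _++_; [_]; map; tabulate; concat)
open import Data.List.Properties using (++-assoc; ++-identityʳ; ∷-injective; map-++)
open import Data.List.Membership.Propositional using (_∈_; _∉_)
open import Data.List.Membership.Propositional.Properties
  using (∈-++⁺ˡ; ∈-++⁺ʳ; ∈-++⁻; ∈-map⁺; ∈-map⁻; ∈-concat⁺′; ∈-tabulate⁺; ∈-tabulate⁻)
open import Data.List.Relation.Unary.Any using (here; there)
open import Data.Vec as Vec using (Vec; []; _∷_; lookup)
open import Data.Vec.Properties using (lookup-map)
open import Data.Product using (Σ; _×_; _,_; ∃-syntax; proj₁; proj₂)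
open import Data.Sum using (_⊎_; inj₁; inj₂; [_,_]′)
open import Data.Empty using (⊥-elim)
open import Relation.Binary.PropositionalEquality
  using (_≡_; _≢_; refl; subst; cong; cong₂; trans; subst-subst; subst-subst-sym)
  renaming (sym to ≡-sym)
open import Relation.Binary.Definitions using (tri<; tri≈; tri>)
open import Axiom.UniquenessOfIdentityProofs.WithK using (uip)

-- The obstacle is the eigenvariable condition of `R∃←`: the literal witnessing an existential
-- formula must occur nowhere in the side formulas, while `X` may already use every literal, and
-- derivations have to stay inside `L`, so no new constants can be adjoined. σ is injective but not
-- onto, so no left inverse of it is injective, and a refutation of the shifted formulas may mention
-- literals outside the image of σ. A single derivation involves only finitely many hypotheses,
-- though, and on these an injective renaming can undo σ. Excluded middle, given as `decide`, drives
-- the stages of the extension and picks representatives in the term model. The injective coding of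
-- words, obtained from countability, serves both as the enumeration of formulas and as the order
-- that singles out least terms. Rules speak of words whereas satisfaction recurses on derivations
-- of `Formula`, so everything semantic rests on unique readability.

module FirstOrder (L : Language) where
  open Language L

  private
    W : Set
    W = Word L

  ∉-lit-neg : ∀ {s n} → ar s ≡ -[1+ n ] → ¬ IsLiteral L s
  ∉-lit-neg p q with trans (≡-sym p) q
  ... | ()

  -- Unique readability

  mutual
    -- The tails `w` and `w'` let the induction cross concatenations: peeling off one argument
    -- leaves the others as a tail. Equality in the `Σ` type identifies a word together with its
    -- derivation, so later matches need no transport.
    prefix-Term : ∀ {t t' w w'} (d : Term L t) (d' : Term L t') → t ++ w ≡ t' ++ w' →
      _≡_ {A = Σ W (Term L)} (t , d) (t' , d') × w ≡ w'
    prefix-Term (app p ds) (app p' ds') eq with ∷-injective eq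
    ... | refl , eq' with +-injective (trans (≡-sym p) p')
    ... | refl with uip p p'
    ... | refl with prefix-Terms ds ds' eq'
    ... | refl , e = refl , e

    prefix-Terms : ∀ {n} {ts ts' : Vec W n} {w w'} (ds : Terms L ts) (ds' : Terms L ts') →
      concatV L ts ++ w ≡ concatV L ts' ++ w' →
      _≡_ {A = Σ (Vec W n) (Terms L)} (ts , ds) (ts' , ds') × w ≡ w'
    prefix-Terms [] [] eq = refl , eq
    prefix-Terms {ts = t ∷ ts} {t' ∷ ts'} (d ∷ ds) (d' ∷ ds') eq
      with prefix-Term d d' (trans (≡-sym (++-assoc t _ _)) (trans eq (++-assoc t' _ _)))
    ... | refl , eq' with prefix-Terms ds ds' eq'
    ... | refl , e = refl , e

  prefix-Formula : ∀ {φ φ' w w'} (d : Formula L φ) (d' : Formula L φ') → φ ++ w ≡ φ' ++ w' →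
    _≡_ {A = Σ W (Formula L)} (φ , d) (φ' , d') × w ≡ w'
  prefix-Formula (atom p ds) (atom p' ds') eq with ∷-injective eq
  ... | refl , eq' with -[1+-injective (trans (≡-sym p) p')
  ... | refl with uip p p'
  ... | refl with prefix-Terms ds ds' eq'
  ... | refl , e = refl , e
  prefix-Formula (atom p ds) (nor _ _) eq with ∷-injective eq
  ... | () , _
  prefix-Formula (atom p ds) (ex q _) eq with ∷-injective eq
  ... | refl , _ = ⊥-elim (∉-lit-neg p q)
  prefix-Formula (nor _ _) (atom p ds) eq with ∷-injective eq
  ... | () , _
  prefix-Formula (nor {φ} {ψ} d e) (nor {φ'} {ψ'} d' e') eq
    with prefix-Formula d d' (trans (≡-sym (++-assoc φ _ _)) (trans (proj₂ (∷-injective eq)) (++-assoc φ' _ _)))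
  ... | refl , eq' with prefix-Formula e e' eq'
  ... | refl , r = refl , r
  prefix-Formula (nor _ _) (ex q _) eq with ∷-injective eq
  ... | () , _
  prefix-Formula (ex q _) (atom p ds) eq with ∷-injective eq
  ... | refl , _ = ⊥-elim (∉-lit-neg p q)
  prefix-Formula (ex q _) (nor _ _) eq with ∷-injective eq
  ... | () , _
  prefix-Formula (ex q d) (ex q' d') eq with ∷-injective eq
  ... | refl , eq' with uip q q'
  ... | refl with prefix-Formula d d' eq'
  ... | refl , e = refl , e

  -- `Sat` recurses on the derivation that `Holds` hides; uniqueness allows it to be exchanged for
  -- one ending in a known constructor.
  Formula-irrelevant : ∀ {φ} (d d' : Formula L φ) → d ≡ d'
  Formula-irrelevant d d' with prefix-Formula {w = []} d d' refl
  ... | refl , _ = refl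

  -- Literal renamings

  mapL : (Sym → Sym) → Letter L → Letter L
  mapL f ↓       = ↓
  mapL f (sym s) = sym (f s)

  mapW : (Sym → Sym) → W → W
  mapW f = map (mapL f)

  -- Injectivity is demanded separately, because the replacement of one literal by another is to be
  -- an instance. Fixing the non-literals keeps `eqs` and all relations in place.
  record Renaming : Set where
    field
      fn  : Sym → Sym
      arf : ∀ s → ar (fn s) ≡ ar s
      fix : ∀ s → ¬ IsLiteral L s → fn s ≡ s
  open Renaming

  ren : Renaming → W → W
  ren ρ = mapW (fn ρ)

  single : ∀ {v v'} → IsLiteral L v → IsLiteral L v' → Renaming
  single {v} {v'} p p' = record { fn = f ; arf = arf' ; fix = fix' }
    where
    f : Sym → Sym
    f s with s ≟ v
    ... | yes _ = v'
    ... | no  _ = s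
    arf' : ∀ s → ar (f s) ≡ ar s
    arf' s with s ≟ v
    ... | yes refl = trans p' (≡-sym p)
    ... | no  _ = refl
    fix' : ∀ s → ¬ IsLiteral L s → f s ≡ s
    fix' s l with s ≟ v
    ... | yes refl = ⊥-elim (l p)
    ... | no  _ = refl

  single-word : ∀ {v v'} (p : IsLiteral L v) (p' : IsLiteral L v') w →
    ren (single p p') w ≡ _[_/_] L w v v'
  single-word p p' [] = refl
  single-word p p' (↓ ∷ w) = cong (↓ ∷_) (single-word p p' w)
  single-word {v} p p' (sym s ∷ w) with s ≟ v
  ... | yes _ = cong (_ ∷_) (single-word p p' w)
  ... | no  _ = cong (_ ∷_) (single-word p p' w)

  mapW-concatV : ∀ f {n} (ts : Vec W n) → mapW f (concatV L ts) ≡ concatV L (Vec.map (mapW f) ts)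
  mapW-concatV f [] = refl
  mapW-concatV f (t ∷ ts) = trans (map-++ (mapL f) t _) (cong (mapW f t ++_) (mapW-concatV f ts))

  ren-sym : ∀ ρ {s n} → ar s ≡ -[1+ n ] → fn ρ s ≡ s
  ren-sym ρ p = fix ρ _ (∉-lit-neg p)

  ren-eqW : ∀ ρ t₁ t₂ → ren ρ (eqW L t₁ t₂) ≡ eqW L (ren ρ t₁) (ren ρ t₂)
  ren-eqW ρ t₁ t₂ = cong₂ (λ a b → sym a ∷ b) (ren-sym ρ ar-eqs) (map-++ _ t₁ t₂)

  ren-norW : ∀ ρ φ ψ → ren ρ (norW L φ ψ) ≡ norW L (ren ρ φ) (ren ρ ψ)
  ren-norW ρ φ ψ = cong (↓ ∷_) (map-++ _ φ ψ)

  mutual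
    ren-Term : ∀ ρ {t} → Term L t → Term L (ren ρ t)
    ren-Term ρ (app {s} p {ts} ds) =
      subst (λ w → Term L (sym (fn ρ s) ∷ w)) (≡-sym (mapW-concatV _ ts))
        (app (trans (arf ρ s) p) (ren-Terms ρ ds))

    ren-Terms : ∀ ρ {n} {ts : Vec W n} → Terms L ts → Terms L (Vec.map (ren ρ) ts)
    ren-Terms ρ [] = []
    ren-Terms ρ (d ∷ ds) = ren-Term ρ d ∷ ren-Terms ρ ds

  ren-atomW : ∀ ρ {r n m} → ar r ≡ -[1+ n ] → (ts : Vec W m) →
    ren ρ (sym r ∷ concatV L ts) ≡ sym r ∷ concatV L (Vec.map (ren ρ) ts)
  ren-atomW ρ p ts = cong₂ (λ a b → sym a ∷ b) (ren-sym ρ p) (mapW-concatV _ ts)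

  -- Formulas of nesting depth at most n: renamings and term substitutions
  -- preserve this bound, which the induction of the truth lemma needs.
  data Depth≤ : ℕ → W → Set where
    atom : ∀ {n r k} → ar r ≡ -[1+ k ] → {ts : Vec W (suc k)} → Terms L ts →
           Depth≤ n (sym r ∷ concatV L ts)
    nor  : ∀ {n φ ψ} → Depth≤ n φ → Depth≤ n ψ → Depth≤ (suc n) (norW L φ ψ)
    ex   : ∀ {n v φ} → IsLiteral L v → Depth≤ n φ → Depth≤ (suc n) (sym v ∷ φ)

  Depth-Formula : ∀ {n φ} → Depth≤ n φ → Formula L φ
  Depth-Formula (atom p ds) = atom p ds
  Depth-Formula (nor d e)   = nor (Depth-Formula d) (Depth-Formula e)
  Depth-Formula (ex p d)    = ex p (Depth-Formula d)

  Depth-mono : ∀ {m n φ} → m ≤ n → Depth≤ m φ → Depth≤ n φ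
  Depth-mono le       (atom p ds) = atom p ds
  Depth-mono (s≤s le) (nor d e)   = nor (Depth-mono le d) (Depth-mono le e)
  Depth-mono (s≤s le) (ex p d)    = ex p (Depth-mono le d)

  Formula-Depth : ∀ {φ} → Formula L φ → ∃[ n ] Depth≤ n φ
  Formula-Depth (atom p ds) = 0 , atom p ds
  Formula-Depth (nor d e) with Formula-Depth d | Formula-Depth e
  ... | m , d' | n , e' = _ , nor (Depth-mono (m≤m⊔n m n) d') (Depth-mono (m≤n⊔m m n) e')
  Formula-Depth (ex p d) with Formula-Depth d
  ... | n , d' = suc n , ex p d'

  ren-Depth : ∀ ρ {n φ} → Depth≤ n φ → Depth≤ n (ren ρ φ)
  ren-Depth ρ (atom p {ts} ds) =
    subst (Depth≤ _) (≡-sym (ren-atomW ρ p ts)) (atom p (ren-Terms ρ ds))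
  ren-Depth ρ (nor {φ = φ} {ψ} d e) =
    subst (Depth≤ _) (≡-sym (ren-norW ρ φ ψ)) (nor (ren-Depth ρ d) (ren-Depth ρ e))
  ren-Depth ρ (ex {v = v} p d) = ex (trans (arf ρ v) p) (ren-Depth ρ d)

  ren-Formula : ∀ ρ {φ} → Formula L φ → Formula L (ren ρ φ)
  ren-Formula ρ d = Depth-Formula (ren-Depth ρ (proj₂ (Formula-Depth d)))

  -- Interpretations over a fixed universe

  module Sem {U : Set} (u₀ : U) where

    Str : Set
    Str = (s : Sym) → Den L U (ar s)

    ⟨_⟩ : Str → Interp L
    ⟨ a ⟩ = record { U = U ; u₀ = u₀ ; int = a }

    upd : Str → (v : Sym) → IsLiteral L v → U → Str
    upd a v p u = Interp.int (update L ⟨ a ⟩ v p u)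

    upd-same : ∀ a v p u → upd a v p u v ≡ subst (Den L U) (≡-sym p) (λ _ → u)
    upd-same a v p u with v ≟ v
    ... | yes refl = refl
    ... | no n = ⊥-elim (n refl)

    upd-diff : ∀ a v p u {s} → s ≢ v → upd a v p u s ≡ a s
    upd-diff a v p u {s} ne with s ≟ v
    ... | yes e = ⊥-elim (ne e)
    ... | no _ = refl

    Holds-nor⁻ : ∀ {a φ ψ} → Formula L φ → Formula L ψ → Holds L ⟨ a ⟩ (norW L φ ψ) →
      ¬ Holds L ⟨ a ⟩ φ × ¬ Holds L ⟨ a ⟩ ψ
    Holds-nor⁻ {a} d e (f , h) with Formula-irrelevant f (nor d e)
    Holds-nor⁻ {a} d e (f , h₁ , h₂) | refl =
      (λ (d' , h) → h₁ (subst (Sat L ⟨ a ⟩) (Formula-irrelevant d' d) h)) ,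
      (λ (e' , h) → h₂ (subst (Sat L ⟨ a ⟩) (Formula-irrelevant e' e) h))

    Holds-nor⁺ : ∀ {a φ ψ} → Formula L φ → Formula L ψ →
      ¬ Holds L ⟨ a ⟩ φ → ¬ Holds L ⟨ a ⟩ ψ → Holds L ⟨ a ⟩ (norW L φ ψ)
    Holds-nor⁺ d e h₁ h₂ = nor d e , (λ h → h₁ (d , h)) , (λ h → h₂ (e , h))

    Holds-ex⁻ : ∀ {a v φ} (p : IsLiteral L v) → Formula L φ → Holds L ⟨ a ⟩ (sym v ∷ φ) →
      ∃[ u ] Holds L ⟨ upd a v p u ⟩ φ
    Holds-ex⁻ p d (f , h) with Formula-irrelevant f (ex p d)
    Holds-ex⁻ p d (f , u , h) | refl = u , d , h

    Holds-ex⁺ : ∀ {a v φ} (p : IsLiteral L v) {u} → Holds L ⟨ upd a v p u ⟩ φ →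
      Holds L ⟨ a ⟩ (sym v ∷ φ)
    Holds-ex⁺ p (d , h) = ex p d , _ , h

    Holds-atom⁻ : ∀ {a r n} {ts : Vec W (suc n)} (p : ar r ≡ -[1+ n ]) (ds : Terms L ts) →
      Holds L ⟨ a ⟩ (sym r ∷ concatV L ts) → Sat L ⟨ a ⟩ (atom p ds)
    Holds-atom⁻ p ds (f , h) with Formula-irrelevant f (atom p ds)
    ... | refl = h

    Sat-atom : ∀ {a b r n} (p : ar r ≡ -[1+ n ]) {ts ts' : Vec W (suc n)}
      (ds : Terms L ts) (ds' : Terms L ts') → a r ≡ b r →
      evalTs L ⟨ a ⟩ ds ≡ evalTs L ⟨ b ⟩ ds' → Sat L ⟨ a ⟩ (atom p ds) → Sat L ⟨ b ⟩ (atom p ds')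
    Sat-atom {r = r} {n} p ds ds' e es h with r ≟ eqs
    ... | yes _ = subst (eqVal L n) es h
    ... | no _ = subst T (cong₂ (λ F us → subst (Den L U) p F us) e es) h

    -- Derivations of renamed or substituted words arise by transport along word equations; packed
    -- with the value, both are transported at once.
    HasVal : Str → W → U → Set
    HasVal a t u = Σ (Term L t) λ d → evalT L ⟨ a ⟩ d ≡ u

    HasVals : Str → ∀ {n} → Vec W n → Vec U n → Set
    HasVals a ts us = Σ (Terms L ts) λ ds → evalTs L ⟨ a ⟩ ds ≡ us

    -- Renaming lemma

    -- `a` is the pullback of `b` along `ρ`, demanded only at the symbols of `w` because the two may
    -- differ elsewhere.
    Agree : Renaming → Str → Str → W → Set
    Agree ρ a b w = ∀ s → sym s ∈ w → a s ≡ subst (Den L U) (arf ρ s) (b (fn ρ s))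

    mutual
      eval-ren : ∀ ρ {a b t} (d : Term L t) → Agree ρ a b t → HasVal b (ren ρ t) (evalT L ⟨ a ⟩ d)
      eval-ren ρ {a} {b} (app {s} p {ts} ds) ag with evals-ren ρ ds (λ s m → ag s (there m))
      ... | ds' , e = subst (λ w → HasVal b (sym (fn ρ s) ∷ w) (evalT L ⟨ a ⟩ (app p ds)))
              (≡-sym (mapW-concatV _ ts))
              (app (trans (arf ρ s) p) ds' ,
               trans (cong (subst (Den L U) (trans (arf ρ s) p) (b (fn ρ s))) e)
                     (cong (λ (F : Den L U (+ _)) → F (evalTs L ⟨ a ⟩ ds))
                       (trans (≡-sym (subst-subst {P = Den L U} (arf ρ s) {p}))
                              (cong (subst (Den L U) p) (≡-sym (ag s (here refl)))))))

      evals-ren : ∀ ρ {a b n} {ts : Vec W n} (ds : Terms L ts) → Agree ρ a b (concatV L ts) →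
        HasVals b (Vec.map (ren ρ) ts) (evalTs L ⟨ a ⟩ ds)
      evals-ren ρ [] ag = [] , refl
      evals-ren ρ {ts = t ∷ ts} (d ∷ ds) ag
        with eval-ren ρ d (λ s m → ag s (∈-++⁺ˡ m)) | evals-ren ρ ds (λ s m → ag s (∈-++⁺ʳ t m))
      ... | d' , e | ds' , es = (d' ∷ ds') , cong₂ _∷_ e es

    -- Rules out capture: if a bound literal shared its image with another literal of the word,
    -- updating that image would overwrite the value of the other one.
    InjOn : Renaming → W → Set
    InjOn ρ w = ∀ s s' → sym s ∈ w → sym s' ∈ w → fn ρ s ≡ fn ρ s' → s ≡ s'

    const-subst : ∀ {u z z'} (p : z ≡ + 0) (p' : z' ≡ + 0) (q : z' ≡ z) →
      subst (Den L U) (≡-sym p) (λ _ → u) ≡ subst (Den L U) q (subst (Den L U) (≡-sym p') (λ _ → u))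
    const-subst refl refl refl = refl

    agree-upd : ∀ ρ {a b v w u} (p : IsLiteral L v) → InjOn ρ (sym v ∷ w) → Agree ρ a b (sym v ∷ w) →
      Agree ρ (upd a v p u) (upd b (fn ρ v) (trans (arf ρ v) p) u) w
    agree-upd ρ {a} {b} {v} {w} {u} p inj ag s m with s ≟ v
    ... | yes refl = trans (const-subst p (trans (arf ρ s) p) (arf ρ s))
                       (cong (subst (Den L U) (arf ρ s)) (≡-sym (upd-same b (fn ρ s) (trans (arf ρ s) p) u)))
    ... | no ne = trans (ag s (there m))
                    (cong (subst (Den L U) (arf ρ s))
                      (≡-sym (upd-diff b (fn ρ v) _ u (λ e → ne (inj s v (there m) (here refl) e)))))

    subst-fixed : ∀ (b : Str) {r r'} → r' ≡ r → (q : ar r' ≡ ar r) → subst (Den L U) q (b r') ≡ b r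
    subst-fixed b refl q with uip q refl
    ... | refl = refl

    Holds-ren : ∀ ρ {a b φ} → Formula L φ → InjOn ρ φ → Agree ρ a b φ →
      (Holds L ⟨ a ⟩ φ → Holds L ⟨ b ⟩ (ren ρ φ)) × (Holds L ⟨ b ⟩ (ren ρ φ) → Holds L ⟨ a ⟩ φ)
    Holds-ren ρ {a} {b} (atom {r} p {ts} ds) inj ag with evals-ren ρ ds (λ s m → ag s (there m))
    ... | ds' , e =
      (λ h → subst (Holds L ⟨ b ⟩) (≡-sym (ren-atomW ρ p ts))
         (atom p ds' , Sat-atom p ds ds' ab (≡-sym e) (Holds-atom⁻ p ds h))) ,
      (λ h → atom p ds , Sat-atom p ds' ds (≡-sym ab) e
         (Holds-atom⁻ p ds' (subst (Holds L ⟨ b ⟩) (ren-atomW ρ p ts) h)))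
      where
      ab : a r ≡ b r
      ab = trans (ag r (here refl)) (subst-fixed b (ren-sym ρ p) (arf ρ r))
    Holds-ren ρ {a} {b} (nor {φ} {ψ} d e) inj ag
      with Holds-ren ρ d (λ s s' m m' → inj s s' (there (∈-++⁺ˡ m)) (there (∈-++⁺ˡ m')))
             (λ s m → ag s (there (∈-++⁺ˡ m)))
         | Holds-ren ρ e (λ s s' m m' → inj s s' (there (∈-++⁺ʳ φ m)) (there (∈-++⁺ʳ φ m')))
             (λ s m → ag s (there (∈-++⁺ʳ φ m)))
    ... | to₁ , from₁ | to₂ , from₂ =
      (λ h → let (h₁ , h₂) = Holds-nor⁻ d e h in
         subst (Holds L ⟨ b ⟩) (≡-sym (ren-norW ρ φ ψ))
           (Holds-nor⁺ (ren-Formula ρ d) (ren-Formula ρ e) (λ x → h₁ (from₁ x)) (λ x → h₂ (from₂ x)))) ,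
      (λ h → let (h₁ , h₂) = Holds-nor⁻ (ren-Formula ρ d) (ren-Formula ρ e)
                               (subst (Holds L ⟨ b ⟩) (ren-norW ρ φ ψ) h) in
         Holds-nor⁺ d e (λ x → h₁ (to₁ x)) (λ x → h₂ (to₂ x)))
    Holds-ren ρ {a} {b} (ex {v} {φ} p d) inj ag =
      (λ h → let (u , x) = Holds-ex⁻ p d h in Holds-ex⁺ (trans (arf ρ v) p) (proj₁ (ih u) x)) ,
      (λ h → let (u , x) = Holds-ex⁻ (trans (arf ρ v) p) (ren-Formula ρ d) h in
         Holds-ex⁺ p (proj₂ (ih u) x))
      where
      ih : ∀ u → _
      ih u = Holds-ren ρ {upd a v p u} {upd b (fn ρ v) (trans (arf ρ v) p) u} d
        (λ s s' m m' → inj s s' (there m) (there m')) (agree-upd ρ p inj ag)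


    -- Substitution lemma

    mutual
      eval-coincide : ∀ {a b t} (d : Term L t) → (∀ s → sym s ∈ t → a s ≡ b s) →
        evalT L ⟨ a ⟩ d ≡ evalT L ⟨ b ⟩ d
      eval-coincide (app p ds) ag =
        cong₂ (λ F us → subst (Den L U) p F us) (ag _ (here refl))
          (evals-coincide ds (λ s m → ag s (there m)))

      evals-coincide : ∀ {a b n} {ts : Vec W n} (ds : Terms L ts) →
        (∀ s → sym s ∈ concatV L ts → a s ≡ b s) → evalTs L ⟨ a ⟩ ds ≡ evalTs L ⟨ b ⟩ ds
      evals-coincide [] ag = refl
      evals-coincide {ts = t ∷ ts} (d ∷ ds) ag =
        cong₂ _∷_ (eval-coincide d (λ s m → ag s (∈-++⁺ˡ m)))
                  (evals-coincide ds (λ s m → ag s (∈-++⁺ʳ t m)))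

    upd-cong : ∀ {a b v u u' s} (p : IsLiteral L v) → a s ≡ b s → u ≡ u' →
      upd a v p u s ≡ upd b v p u' s
    upd-cong {v = v} {s = s} p e refl with s ≟ v
    ... | yes refl = refl
    ... | no _ = e

  replace-++ : ∀ v t w w' → replace L v t (w ++ w') ≡ replace L v t w ++ replace L v t w'
  replace-++ v t [] w' = refl
  replace-++ v t (↓ ∷ w) w' = cong (↓ ∷_) (replace-++ v t w w')
  replace-++ v t (sym s ∷ w) w' with s ≟ v
  ... | yes _ = trans (cong (t ++_) (replace-++ v t w w')) (≡-sym (++-assoc t _ _))
  ... | no  _ = cong (sym s ∷_) (replace-++ v t w w')

  replace-concatV : ∀ v t {n} (ts : Vec W n) →
    replace L v t (concatV L ts) ≡ concatV L (Vec.map (replace L v t) ts)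
  replace-concatV v t [] = refl
  replace-concatV v t (w ∷ ts) = trans (replace-++ v t w _) (cong (_ ++_) (replace-concatV v t ts))

  module _ {v t} (pv : IsLiteral L v) (td : Term L t) where

    mutual
      replace-Term : ∀ {w} → Term L w → Term L (replace L v t w)
      replace-Term (app {s} p {ts} ds) with s ≟ v
      ... | no _ = subst (λ x → Term L (sym s ∷ x)) (≡-sym (replace-concatV v t ts))
                     (app p (replace-Terms ds))
      -- The head is the literal `v`, so the arity is 0 and the argument list is empty.
      ... | yes refl with +-injective (trans (≡-sym p) pv)
      replace-Term (app p []) | yes refl | refl = subst (Term L) (≡-sym (++-identityʳ t)) td

      replace-Terms : ∀ {n} {ts : Vec W n} → Terms L ts → Terms L (Vec.map (replace L v t) ts)
      replace-Terms [] = []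
      replace-Terms (d ∷ ds) = replace-Term d ∷ replace-Terms ds

    module _ {U : Set} (u₀ : U) where
      open Sem u₀

      at : Str → Str
      at b = upd b v pv (evalT L ⟨ b ⟩ td)

      mutual
        eval-replace : ∀ b {w} (d : Term L w) → HasVal b (replace L v t w) (evalT L ⟨ at b ⟩ d)
        eval-replace b (app {s} p {ts} ds) with s ≟ v
        ... | no _ = let (ds' , e) = evals-replace b ds in
                subst (λ x → HasVal b (sym s ∷ x) (subst (Den L U) p (b s) (evalTs L ⟨ at b ⟩ ds)))
                  (≡-sym (replace-concatV v t ts))
                  (app p ds' , cong (subst (Den L U) p (b s)) e)
        ... | yes refl with +-injective (trans (≡-sym p) pv)
        eval-replace b (app p []) | yes refl | refl with uip p pv
        ... | refl = subst (λ x → HasVal b x (subst (Den L U) p (subst (Den L U) (≡-sym p) (λ _ → evalT L ⟨ b ⟩ td)) []))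
                       (≡-sym (++-identityʳ t))
                       (td , cong (λ (F : Den L U (+ 0)) → F []) (≡-sym (subst-subst-sym p)))

        evals-replace : ∀ b {n} {ts : Vec W n} (ds : Terms L ts) →
          HasVals b (Vec.map (replace L v t) ts) (evalTs L ⟨ at b ⟩ ds)
        evals-replace b [] = [] , refl
        evals-replace b (d ∷ ds) with eval-replace b d | evals-replace b ds
        ... | d' , e | ds' , es = (d' ∷ ds') , cong₂ _∷_ e es

  symbols : W → List Sym
  symbols [] = []
  symbols (↓ ∷ w) = symbols w
  symbols (sym s ∷ w) = s ∷ symbols w

  ∈-symbols : ∀ {s w} → sym s ∈ w → s ∈ symbols w
  ∈-symbols {w = ↓ ∷ w} (there m) = ∈-symbols m
  ∈-symbols {w = sym s ∷ w} (here refl) = here refl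
  ∈-symbols {w = sym s ∷ w} (there m) = there (∈-symbols m)

  fresh : ∀ w → ∃[ v ] (IsLiteral L v × ¬ Occurs L v w)
  fresh w with lits-inf (symbols w)
  ... | v , p , n = v , p , λ m → n (∈-symbols m)

  single-inj : ∀ {v v' w} (p : IsLiteral L v) (p' : IsLiteral L v') → ¬ Occurs L v' w →
    ∀ s s' → sym s ∈ w → sym s' ∈ w → fn (single p p') s ≡ fn (single p p') s' → s ≡ s'
  single-inj {v} p p' nv s s' m m' e with s ≟ v | s' ≟ v
  ... | yes refl | yes refl = refl
  ... | yes refl | no _ = ⊥-elim (nv (subst (λ x → sym x ∈ _) (≡-sym e) m'))
  ... | no _ | yes refl = ⊥-elim (nv (subst (λ x → sym x ∈ _) e m))
  ... | no _ | no _ = e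

  Substituted : ∀ {U : Set} (u₀ : U) {v t} → IsLiteral L v → Term L t → W → W → Set
  Substituted u₀ pv td ψ χ = let open Sem u₀ in
    ∀ b → (Holds L ⟨ b ⟩ χ → Holds L ⟨ at pv td u₀ b ⟩ ψ) × (Holds L ⟨ at pv td u₀ b ⟩ ψ → Holds L ⟨ b ⟩ χ)

  -- `TSub` leaves the renaming literal open, so one value `χ` is constructed, along with what the
  -- truth lemma needs of it. Recursion is on the bound `n`: in the quantifier case it runs on the
  -- renamed body, which is not a subderivation of the given one.
  term-substitution : ∀ {U : Set} (u₀ : U) {v t} (pv : IsLiteral L v) (td : Term L t) {n ψ} → Depth≤ n ψ →
    ∃[ χ ] (TSub L v t ψ χ × Depth≤ n χ × Substituted u₀ pv td ψ χ)
  term-substitution u₀ {v} {t} pv td (atom {r = r} p {ts} ds) =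
    sym r ∷ replace L v t (concatV L ts) , atomT p ds ,
    subst (λ x → Depth≤ _ (sym r ∷ x)) (≡-sym (replace-concatV v t ts)) (atom p (replace-Terms pv td ds)) ,
    λ b → let (ds' , e) = evals-replace pv td u₀ b ds in
      (λ h → atom p ds , Sat-atom p ds' ds (≡-sym (same b)) e
        (Holds-atom⁻ p ds' (subst (λ x → Holds L ⟨ b ⟩ (sym r ∷ x)) (replace-concatV v t ts) h))) ,
      (λ h → subst (λ x → Holds L ⟨ b ⟩ (sym r ∷ x)) (≡-sym (replace-concatV v t ts))
        (atom p ds' , Sat-atom p ds ds' (same b) (≡-sym e) (Holds-atom⁻ p ds h)))
    where
    open Sem u₀
    same : ∀ b → at pv td u₀ b r ≡ b r
    same b = upd-diff b v pv _ (λ { refl → ∉-lit-neg p pv })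
  term-substitution u₀ pv td (nor d e)
    with term-substitution u₀ pv td d | term-substitution u₀ pv td e
  ... | χ₁ , s₁ , d₁ , h₁ | χ₂ , s₂ , d₂ , h₂ =
    norW L χ₁ χ₂ , norT (Depth-Formula d) (Depth-Formula e) s₁ s₂ , nor d₁ d₂ ,
    λ b →
      (λ h → let (x , y) = Holds-nor⁻ (Depth-Formula d₁) (Depth-Formula d₂) h in
        Holds-nor⁺ (Depth-Formula d) (Depth-Formula e) (λ z → x (proj₂ (h₁ b) z)) (λ z → y (proj₂ (h₂ b) z))) ,
      (λ h → let (x , y) = Holds-nor⁻ (Depth-Formula d) (Depth-Formula e) h in
        Holds-nor⁺ (Depth-Formula d₁) (Depth-Formula d₂) (λ z → x (proj₁ (h₁ b) z)) (λ z → y (proj₁ (h₂ b) z)))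
    where open Sem u₀
  term-substitution {U} u₀ {v} {t} pv td (ex {v = v₁} {φ} p d) with fresh (sym v ∷ t ++ φ)
  ... | v' , p' , nv with term-substitution u₀ pv td (ren-Depth (single p p') d)
  ... | χ , s , dχ , hχ =
    sym v' ∷ χ ,
    exT p (Depth-Formula d) p' v'≢v v'∉t v'∉φ (subst (λ x → TSub L v t x χ) (single-word p p' φ) s) ,
    ex p' dχ ,
    λ b →
      (λ h → let (u , x) = Holds-ex⁻ p' (Depth-Formula dχ) h in
        Holds-ex⁺ p (proj₂ (renamed b u) (proj₁ (hχ _) x))) ,
      (λ h → let (u , x) = Holds-ex⁻ p (Depth-Formula d) h in
        Holds-ex⁺ p' (proj₂ (hχ _) (proj₁ (renamed b u) x)))
    where
    open Sem u₀
    v'≢v : v' ≢ v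
    v'≢v refl = nv (here refl)
    v'∉t : ¬ Occurs L v' t
    v'∉t m = nv (there (∈-++⁺ˡ m))
    v'∉φ : ¬ Occurs L v' φ
    v'∉φ m = nv (there (∈-++⁺ʳ t m))
    -- The two updates commute up to the renaming. At `v₁` both sides give `u`, since `v'` differs
    -- from `v`; elsewhere `v'` does not occur in `φ`, and the value of `t` does not depend on `v'`.
    agree : ∀ b u → Agree (single p p') (upd (at pv td u₀ b) v₁ p u) (at pv td u₀ (upd b v' p' u)) φ
    agree b u s m with s ≟ v₁
    ... | yes refl = trans (const-subst p p' (trans p' (≡-sym p)))
                       (cong (subst (Den L U) (trans p' (≡-sym p)))
                         (≡-sym (trans (upd-diff _ v pv _ v'≢v) (upd-same b v' p' u))))
    ... | no _ = upd-cong pv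
                   (≡-sym (upd-diff b v' p' u (λ { refl → v'∉φ m })))
                   (eval-coincide td (λ s' m' → ≡-sym (upd-diff b v' p' u (λ { refl → v'∉t m' }))))
    renamed : ∀ b u → _
    renamed b u = Holds-ren (single p p') {upd (at pv td u₀ b) v₁ p u} {at pv td u₀ (upd b v' p' u)}
      (Depth-Formula d) (single-inj p p' v'∉φ) (agree b u)

  -- Derivability

  iterate : ℕ → SeqSet L
  iterate n = iter L n (O L (D₁ L)) (∅ˢ L)

  Der : List W → W → Set
  Der Γ φ = ∃[ n ] iterate n (Γ , φ)

  pattern init x   = inj₁ x
  pattern eqRefl x = inj₂ (inj₁ x)
  pattern eqSym x  = inj₂ (inj₂ (inj₁ x))
  pattern eqTrn x  = inj₂ (inj₂ (inj₂ (inj₁ x)))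
  pattern congF x  = inj₂ (inj₂ (inj₂ (inj₂ (inj₁ x))))
  pattern congR x  = inj₂ (inj₂ (inj₂ (inj₂ (inj₂ (inj₁ x)))))
  pattern exIntr x = inj₂ (inj₂ (inj₂ (inj₂ (inj₂ (inj₂ (inj₁ x))))))
  pattern norR x   = inj₂ (inj₂ (inj₂ (inj₂ (inj₂ (inj₂ (inj₂ (inj₁ x)))))))
  pattern exElim x = inj₂ (inj₂ (inj₂ (inj₂ (inj₂ (inj₂ (inj₂ (inj₂ (inj₁ x))))))))
  pattern contr x  = inj₂ (inj₂ (inj₂ (inj₂ (inj₂ (inj₂ (inj₂ (inj₂ (inj₂ (inj₁ x)))))))))
  pattern weak x   = inj₂ (inj₂ (inj₂ (inj₂ (inj₂ (inj₂ (inj₂ (inj₂ (inj₂ (inj₂ (inj₁ x))))))))))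
  pattern dneg x   = inj₂ (inj₂ (inj₂ (inj₂ (inj₂ (inj₂ (inj₂ (inj₂ (inj₂ (inj₂ (inj₂ (inj₁ x)))))))))))

  O-mono : ∀ {A B : SeqSet L} → (∀ {s} → A s → B s) → ∀ {s} → O L (D₁ L) A s → O L (D₁ L) B s
  O-mono A⊆B (init x)   = init x
  O-mono A⊆B (eqRefl x) = eqRefl x
  O-mono A⊆B (eqSym x)  = eqSym x
  O-mono A⊆B (eqTrn x)  = eqTrn x
  O-mono A⊆B (congF x)  = congF x
  O-mono A⊆B (congR x)  = congR x
  O-mono A⊆B (exIntr x) = exIntr x
  O-mono A⊆B (norR x)   = norR x
  O-mono A⊆B (exElim (Γ' , Δ , ψ , v , v₁ , v₂ , f , g , l , l₁ , l₂ , d , rest)) =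
    exElim (Γ' , Δ , ψ , v , v₁ , v₂ , f , g , l , l₁ , l₂ , A⊆B d , rest)
  O-mono A⊆B (contr (φ₀ , ψ , Δ₁ , Δ₂ , e , e₁ , e₂ , d₁ , d₂)) =
    contr (φ₀ , ψ , Δ₁ , Δ₂ , e , e₁ , e₂ , A⊆B d₁ , A⊆B d₂)
  O-mono A⊆B (weak (f , Γ' , d , sub)) = weak (f , Γ' , A⊆B d , sub)
  O-mono A⊆B (dneg d) = dneg (A⊆B d)

  -- The stages grow because the operator is monotone and the initial stage is empty. Premises of
  -- different heights can thus be brought to a common stage.
  iterate-suc : ∀ n {s} → iterate n s → iterate (suc n) s
  iterate-suc (suc n) x = O-mono (iterate-suc n) x

  iterate-+ : ∀ k n {s} → iterate n s → iterate (k + n) s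
  iterate-+ zero n x = x
  iterate-+ (suc k) n x = iterate-suc (k + n) (iterate-+ k n x)

  -- Derivability is preserved by injective renamings

  module Equivariance (ρ : Renaming) (inj : ∀ {s s'} → fn ρ s ≡ fn ρ s' → s ≡ s') where

    private
      r : W → W
      r = ren ρ

      mapL-inj : ∀ {a b} → mapL (fn ρ) a ≡ mapL (fn ρ) b → a ≡ b
      mapL-inj {↓} {↓} e = refl
      mapL-inj {sym s} {sym s'} e with fn ρ s in p | fn ρ s' in q
      mapL-inj {sym s} {sym s'} refl | _ | _ = cong sym (inj (trans p (≡-sym q)))

    r-inj : ∀ {w w'} → r w ≡ r w' → w ≡ w'
    r-inj {[]} {[]} e = refl
    r-inj {a ∷ w} {b ∷ w'} e with ∷-injective e
    ... | p , q = cong₂ _∷_ (mapL-inj p) (r-inj q)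

    ¬Occurs-r : ∀ {s w} → ¬ Occurs L s w → ¬ Occurs L (fn ρ s) (r w)
    ¬Occurs-r n m with ∈-map⁻ (mapL (fn ρ)) m
    ... | sym s' , m' , e with mapL-inj {sym _} {sym s'} e
    ... | refl = n m'

    r-rename : ∀ w v v' → r (_[_/_] L w v v') ≡ _[_/_] L (r w) (fn ρ v) (fn ρ v')
    r-rename [] v v' = refl
    r-rename (↓ ∷ w) v v' = cong (↓ ∷_) (r-rename w v v')
    r-rename (sym s ∷ w) v v' with s ≟ v | fn ρ s ≟ fn ρ v
    ... | yes _    | yes _ = cong (_ ∷_) (r-rename w v v')
    ... | yes refl | no ne = ⊥-elim (ne refl)
    ... | no ne    | yes e = ⊥-elim (ne (inj e))
    ... | no _     | no _  = cong (_ ∷_) (r-rename w v v')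

    r-replace : ∀ v t w → r (replace L v t w) ≡ replace L (fn ρ v) (r t) (r w)
    r-replace v t [] = refl
    r-replace v t (↓ ∷ w) = cong (↓ ∷_) (r-replace v t w)
    r-replace v t (sym s ∷ w) with s ≟ v | fn ρ s ≟ fn ρ v
    ... | yes _    | yes _ = trans (map-++ _ t _) (cong (r t ++_) (r-replace v t w))
    ... | yes refl | no ne = ⊥-elim (ne refl)
    ... | no ne    | yes e = ⊥-elim (ne (inj e))
    ... | no _     | no _  = cong (_ ∷_) (r-replace v t w)

    r-TSub : ∀ {v t ψ χ} → TSub L v t ψ χ → TSub L (fn ρ v) (r t) (r ψ) (r χ)
    r-TSub {v} {t} (atomT {r₀} p {ts} ds) =
      subst (λ w → TSub L (fn ρ v) (r t) (sym (fn ρ r₀) ∷ w) (sym (fn ρ r₀) ∷ r (replace L v t (concatV L ts))))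
        (≡-sym (mapW-concatV _ ts))
        (subst (λ w → TSub L (fn ρ v) (r t) (sym (fn ρ r₀) ∷ concatV L (Vec.map r ts)) (sym (fn ρ r₀) ∷ w))
          (≡-sym (trans (r-replace v t (concatV L ts)) (cong (replace L (fn ρ v) (r t)) (mapW-concatV _ ts))))
          (atomT (trans (arf ρ r₀) p) (ren-Terms ρ ds)))
    r-TSub {v} {t} (norT {φ} {ψ} {φ'} {ψ'} d e a b) =
      subst (λ w → TSub L (fn ρ v) (r t) w (r (norW L φ' ψ'))) (≡-sym (ren-norW ρ φ ψ))
        (subst (TSub L (fn ρ v) (r t) _) (≡-sym (ren-norW ρ φ' ψ'))
          (norT (ren-Formula ρ d) (ren-Formula ρ e) (r-TSub a) (r-TSub b)))
    r-TSub (exT {v₁} {v'} {φ} p d p' ne nt nφ s) =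
      exT (trans (arf ρ v₁) p) (ren-Formula ρ d) (trans (arf ρ v') p') (λ e → ne (inj e))
        (¬Occurs-r nt) (¬Occurs-r nφ)
        (subst (λ w → TSub L _ _ w _) (r-rename φ v₁ v') (r-TSub s))

    r-AllF : ∀ {Γ} → AllF L Γ → AllF L (map r Γ)
    r-AllF [] = []
    r-AllF (d ∷ ds) = ren-Formula ρ d ∷ r-AllF ds

    r-≐ : ∀ {Γ P Q} → _≐_ L Γ P → (∀ x → P x → Q (r x)) → (∀ y → Q y → ∃[ x ] (P x × y ≡ r x)) →
      _≐_ L (map r Γ) Q
    r-≐ {Γ} {P} {Q} eq to from y =
      (λ m → let (x , m' , e) = ∈-map⁻ r m in subst Q (≡-sym e) (to x (proj₁ (eq x) m'))) ,
      (λ q → let (x , p , e) = from y q in subst (_∈ map r Γ) (≡-sym e) (∈-map⁺ r (proj₂ (eq x) p)))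

    r-≐-one : ∀ {Γ a a'} → r a ≡ a' → _≐_ L Γ (_≡ a) → _≐_ L (map r Γ) (_≡ a')
    r-≐-one {a = a} refl eq = r-≐ eq (λ { x refl → refl }) (λ { y refl → a , refl , refl })

    r-≐-two : ∀ {Γ a b a' b'} → r a ≡ a' → r b ≡ b' → _≐_ L Γ (λ x → x ≡ a ⊎ x ≡ b) →
      _≐_ L (map r Γ) (λ x → x ≡ a' ⊎ x ≡ b')
    r-≐-two {a = a} {b} refl refl eq =
      r-≐ eq (λ { x (inj₁ refl) → inj₁ refl ; x (inj₂ refl) → inj₂ refl })
        (λ { y (inj₁ refl) → a , inj₁ refl , refl ; y (inj₂ refl) → b , inj₂ refl , refl })

    r-negW : ∀ φ → r (negW L φ) ≡ negW L (r φ)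
    r-negW φ = ren-norW ρ φ φ

    r-eqs : ∀ {n} (ts ts' : Vec W n) j →
      r (eqW L (lookup ts j) (lookup ts' j)) ≡ eqW L (lookup (Vec.map r ts) j) (lookup (Vec.map r ts') j)
    r-eqs ts ts' j = trans (ren-eqW ρ (lookup ts j) (lookup ts' j))
      (≡-sym (cong₂ (eqW L) (lookup-map j r ts) (lookup-map j r ts')))

    -- Injectivity preserves the negative side conditions, namely non-occurrence of eigenvariables,
    -- distinctness from the substituted literal and the removal of the instance in `R∃←`, so each
    -- rule instance goes to an instance of the same rule.
    r-iterate : ∀ n {Γ φ} → iterate n (Γ , φ) → iterate n (map r Γ , r φ)
    r-iterate (suc n) (init (d , eq)) = init (ren-Formula ρ d , r-≐-one refl eq)
    r-iterate (suc n) (eqRefl (eq , t , d , refl)) =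
      eqRefl (r-≐ eq (λ _ ()) (λ _ ()) , r t , ren-Term ρ d , ren-eqW ρ t t)
    r-iterate (suc n) (eqSym (t₁ , t₂ , d₁ , d₂ , eq , refl)) =
      eqSym (r t₁ , r t₂ , ren-Term ρ d₁ , ren-Term ρ d₂ , r-≐-one (ren-eqW ρ t₁ t₂) eq , ren-eqW ρ t₂ t₁)
    r-iterate (suc n) (eqTrn (t₁ , t₂ , t₃ , d₁ , d₂ , d₃ , eq , refl)) =
      eqTrn (r t₁ , r t₂ , r t₃ , ren-Term ρ d₁ , ren-Term ρ d₂ , ren-Term ρ d₃ ,
        r-≐-two (ren-eqW ρ t₁ t₂) (ren-eqW ρ t₂ t₃) eq , ren-eqW ρ t₁ t₃)
    r-iterate (suc n) (congF (s , k , ts , ts' , p , ds , ds' , eq , refl)) =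
      congF (fn ρ s , k , Vec.map r ts , Vec.map r ts' , trans (arf ρ s) p , ren-Terms ρ ds , ren-Terms ρ ds' ,
        r-≐ eq (λ { x (j , refl) → j , r-eqs ts ts' j })
          (λ { y (j , refl) → eqW L (lookup ts j) (lookup ts' j) , (j , refl) , ≡-sym (r-eqs ts ts' j) }) ,
        trans (ren-eqW ρ (sym s ∷ concatV L ts) (sym s ∷ concatV L ts'))
          (cong₂ (λ a b → eqW L (sym (fn ρ s) ∷ a) (sym (fn ρ s) ∷ b)) (mapW-concatV _ ts) (mapW-concatV _ ts')))
    r-iterate (suc n) (congR (q , k , ts , ts' , p , ds , ds' , eq , refl)) =
      congR (q , k , Vec.map r ts , Vec.map r ts' , p , ren-Terms ρ ds , ren-Terms ρ ds' ,
        r-≐ eq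
          (λ { x (inj₁ (j , refl)) → inj₁ (j , r-eqs ts ts' j)
             ; x (inj₂ refl) → inj₂ (ren-atomW ρ p ts) })
          (λ { y (inj₁ (j , refl)) → eqW L (lookup ts j) (lookup ts' j) , inj₁ (j , refl) , ≡-sym (r-eqs ts ts' j)
             ; y (inj₂ refl) → sym q ∷ concatV L ts , inj₂ refl , ≡-sym (ren-atomW ρ p ts) }) ,
        ren-atomW ρ p ts')
    r-iterate (suc n) (exIntr (ψ , v , t , χ , d , p , td , s , eq , refl)) =
      exIntr (r ψ , fn ρ v , r t , r χ , ren-Formula ρ d , trans (arf ρ v) p , ren-Term ρ td , r-TSub s ,
        r-≐-one refl eq , refl)
    r-iterate (suc n) (norR (φ₁ , φ₂ , φ₃ , φ₄ , d₁ , d₂ , d₃ , d₄ , eq , refl)) =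
      norR (r φ₁ , r φ₂ , r φ₃ , r φ₄ , ren-Formula ρ d₁ , ren-Formula ρ d₂ , ren-Formula ρ d₃ , ren-Formula ρ d₄ ,
        r-≐-two (ren-norW ρ φ₁ φ₂) (ren-norW ρ φ₃ φ₄) eq , ren-norW ρ φ₂ φ₃)
    r-iterate (suc n) (exElim (Γ' , Δ , ψ , v , v₁ , v₂ , fs , f , p , p₁ , p₂ , d , eq , n₁ , n₂ , eq' , refl)) =
      exElim (map r Γ' , map r Δ , r ψ , fn ρ v , fn ρ v₁ , fn ρ v₂ , r-AllF fs , ren-Formula ρ f ,
        trans (arf ρ v) p , trans (arf ρ v₁) p₁ , trans (arf ρ v₂) p₂ ,
        subst (λ w → iterate n (map r Δ , w)) bot (r-iterate n d) ,
        r-≐ eq (λ { x (inj₁ m) → inj₁ (∈-map⁺ r m) ; x (inj₂ refl) → inj₂ ψ≡ })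
          (λ { y (inj₁ m) → let (x , m' , e) = ∈-map⁻ r m in x , inj₁ m' , e
             ; y (inj₂ refl) → _ , inj₂ refl , ≡-sym ψ≡ }) ,
        (λ y m o → let (x , m' , e) = ∈-map⁻ r m in
          ¬Occurs-r (n₁ x m') (subst (Occurs L (fn ρ v₂)) e o)) ,
        ¬Occurs-r n₂ ,
        r-≐ eq' (λ { x (inj₁ (m , ne)) → inj₁ (∈-map⁺ r m , λ e → ne (r-inj (trans e (≡-sym ψ≡))))
                   ; x (inj₂ refl) → inj₂ refl })
          (λ { y (inj₁ (m , ne)) → let (x , m' , e) = ∈-map⁻ r m in
                 x , inj₁ (m' , λ e' → ne (trans e (trans (cong r e') ψ≡))) , e
             ; y (inj₂ refl) → sym v₁ ∷ ψ , inj₂ refl , refl }) ,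
        bot)
      where
      ψ≡ : r (_[_/_] L ψ v₁ v₂) ≡ _[_/_] L (r ψ) (fn ρ v₁) (fn ρ v₂)
      ψ≡ = r-rename ψ v₁ v₂
      bot : r (negW L (eqW L [ sym v ] [ sym v ])) ≡ negW L (eqW L [ sym (fn ρ v) ] [ sym (fn ρ v) ])
      bot = trans (r-negW (eqW L [ sym v ] [ sym v ])) (cong (negW L) (ren-eqW ρ [ sym v ] [ sym v ]))
    r-iterate (suc n) {Γ} (contr (φ₀ , ψ , Δ₁ , Δ₂ , refl , eq₁ , eq₂ , d₁ , d₂)) =
      contr (r φ₀ , r ψ , map r Δ₁ , map r Δ₂ , r-negW φ₀ , add eq₁ , add eq₂ , r-iterate n d₁ ,
        subst (λ w → iterate n (map r Δ₂ , w)) (r-negW ψ) (r-iterate n d₂))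
      where
      add : ∀ {Δ} → _≐_ L Δ (λ x → x ∈ Γ ⊎ x ≡ φ₀) → _≐_ L (map r Δ) (λ x → x ∈ map r Γ ⊎ x ≡ r φ₀)
      add eq = r-≐ eq (λ { x (inj₁ m) → inj₁ (∈-map⁺ r m) ; x (inj₂ refl) → inj₂ refl })
        (λ { y (inj₁ m) → let (x , m' , e) = ∈-map⁻ r m in x , inj₁ m' , e
           ; y (inj₂ refl) → φ₀ , inj₂ refl , refl })
    r-iterate (suc n) {Γ} (weak (fs , Γ' , d , sub)) =
      weak (r-AllF fs , map r Γ' , r-iterate n d , λ y m →
        let (x , m' , e) = ∈-map⁻ r m in subst (_∈ map r Γ) (≡-sym e) (∈-map⁺ r (sub x m')))
    r-iterate (suc n) {Γ} {φ} (dneg d) =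
      dneg (subst (λ w → iterate n (map r Γ , w)) (trans (r-negW (negW L φ)) (cong (negW L) (r-negW φ))) (r-iterate n d))

    Der-ren : ∀ {Γ φ} → Der Γ φ → Der (map r Γ) (r φ)
    Der-ren (n , d) = n , r-iterate n d

  -- Derived rules over finite contexts

  Forms : List W → Set
  Forms Γ = ∀ x → x ∈ Γ → Formula L x

  Forms-∷ : ∀ {φ Γ} → Formula L φ → Forms Γ → Forms (φ ∷ Γ)
  Forms-∷ d fs x (here refl) = d
  Forms-∷ d fs x (there m)   = fs x m

  Forms-AllF : ∀ {Γ} → Forms Γ → AllF L Γ
  Forms-AllF {[]} fs    = []
  Forms-AllF {φ ∷ Γ} fs = fs φ (here refl) ∷ Forms-AllF (λ x m → fs x (there m))

  Formula-eqW : ∀ {t₁ t₂} → Term L t₁ → Term L t₂ → Formula L (eqW L t₁ t₂)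
  Formula-eqW {t₁} {t₂} d₁ d₂ =
    subst (λ w → Formula L (sym eqs ∷ t₁ ++ w)) (++-identityʳ t₂) (atom ar-eqs (d₁ ∷ d₂ ∷ []))

  ≐-one : ∀ a → _≐_ L (a ∷ []) (_≡ a)
  ≐-one a x = (λ { (here e) → e }) , here

  ≐-two : ∀ a b → _≐_ L (a ∷ b ∷ []) (λ x → x ≡ a ⊎ x ≡ b)
  ≐-two a b x = (λ { (here e) → inj₁ e ; (there (here e)) → inj₂ e }) ,
                (λ { (inj₁ e) → here e ; (inj₂ e) → there (here e) })

  ≐-∷ : ∀ a Γ → _≐_ L (a ∷ Γ) (λ x → x ∈ Γ ⊎ x ≡ a)
  ≐-∷ a Γ x = (λ { (here e) → inj₂ e ; (there m) → inj₁ m }) ,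
              (λ { (inj₁ m) → there m ; (inj₂ e) → here e })

  axiom : ∀ {Γ φ} → O L (D₁ L) (∅ˢ L) (Γ , φ) → Der Γ φ
  axiom x = 1 , x

  Der-weaken : ∀ {Γ Δ φ} → Forms Δ → (∀ x → x ∈ Γ → x ∈ Δ) → Der Γ φ → Der Δ φ
  Der-weaken fs sub (n , d) = suc n , weak (Forms-AllF fs , _ , d , sub)

  Der-hyp : ∀ {Γ φ} → Forms Γ → φ ∈ Γ → Der Γ φ
  Der-hyp {φ = φ} fs m =
    Der-weaken fs (λ { x (here refl) → m }) (axiom (init (fs φ m , ≐-one φ)))

  Der-contra : ∀ {Γ φ ψ} → Der (φ ∷ Γ) ψ → Der (φ ∷ Γ) (negW L ψ) → Der Γ (negW L φ)
  Der-contra {Γ} {φ} {ψ} (m , d) (n , e) =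
    suc (m + n) , contr (φ , ψ , φ ∷ Γ , φ ∷ Γ , refl , ≐-∷ φ Γ , ≐-∷ φ Γ ,
      subst (λ k → iterate k (φ ∷ Γ , ψ)) (+-comm n m) (iterate-+ n m d) , iterate-+ m n e)

  Der-dneg : ∀ {Γ φ} → Der Γ (negW L (negW L φ)) → Der Γ φ
  Der-dneg (n , d) = suc n , dneg d

  Der-refl : ∀ {t} → Term L t → Der [] (eqW L t t)
  Der-refl {t} d = axiom (eqRefl ((λ x → (λ ()) , (λ ())) , t , d , refl))

  -- Falsum in the only shape that `R∃←` can conclude; the choice of the literal is immaterial.
  Bot : Sym → W
  Bot v = negW L (eqW L [ sym v ] [ sym v ])

  Term-lit : ∀ {v} → IsLiteral L v → Term L [ sym v ]
  Term-lit p = app p []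

  -- Reflexivity supplies the formula that `Bot v` negates, so `R꜀` discharges `φ`.
  Der-Bot : ∀ {v Γ φ} → IsLiteral L v → Forms (φ ∷ Γ) → Der (φ ∷ Γ) (Bot v) → Der Γ (negW L φ)
  Der-Bot p fs d = Der-contra (Der-weaken fs (λ x ()) (Der-refl (Term-lit p))) d

  -- `R꜀` has to discharge some hypothesis. The equation of `v` with itself is added to the context
  -- for this purpose, its negation being `Bot v`.
  Der-clash : ∀ {v Γ Γ' φ} → IsLiteral L v → Forms Γ → Forms Γ' → Der Γ φ → Der Γ' (negW L φ) →
    Der (Γ ++ Γ') (Bot v)
  Der-clash {v} {Γ} {Γ'} {φ} p fs fs' d d' = Der-contra
    (Der-weaken all (λ x m → there (∈-++⁺ˡ m)) d) (Der-weaken all (λ x m → there (∈-++⁺ʳ Γ m)) d')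
    where
    all : Forms (eqW L [ sym v ] [ sym v ] ∷ Γ ++ Γ')
    all = Forms-∷ (Formula-eqW (Term-lit p) (Term-lit p))
      (λ x m → [ fs x , fs' x ]′ (∈-++⁻ Γ m))

  split-list : ∀ {P : W → Set} {φ} Γ → (∀ x → x ∈ Γ → P x ⊎ x ≡ φ) →
    ∃[ Γ' ] ((∀ x → x ∈ Γ' → P x) × (∀ x → x ∈ Γ → x ∈ φ ∷ Γ'))
  split-list [] h = [] , (λ x ()) , (λ x ())
  split-list (a ∷ Γ) h with split-list Γ (λ x m → h x (there m)) | h a (here refl)
  ... | Γ' , p , q | inj₂ refl = Γ' , p , λ { x (here refl) → here refl ; x (there m) → q x m }
  ... | Γ' , p , q | inj₁ pa = a ∷ Γ' , (λ { x (here refl) → pa ; x (there m) → p x m }) ,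
    λ { x (here refl) → there (here refl)
      ; x (there m) → [ here , (λ m' → there (there m')) ]′ (cases (q x m)) }
    where
    cases : ∀ {x φ Γ'} → x ∈ φ ∷ Γ' → x ≡ φ ⊎ x ∈ Γ'
    cases (here e) = inj₁ e
    cases (there m) = inj₂ m

  -- Injective renamings are invertible on finite sets

  Inj : Renaming → Set
  Inj ρ = ∀ {s s'} → fn ρ s ≡ fn ρ s' → s ≡ s'

  identity : Renaming
  identity = record { fn = λ s → s ; arf = λ _ → refl ; fix = λ _ _ → refl }

  compose : Renaming → Renaming → Renaming
  compose τ ρ = record
    { fn = λ s → fn τ (fn ρ s)
    ; arf = λ s → trans (arf τ _) (arf ρ s)
    ; fix = λ s l → trans (cong (fn τ) (fix ρ s l)) (fix τ s l) }

  swap : Sym → Sym → Sym → Sym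
  swap a b s with s ≟ a
  ... | yes _ = b
  ... | no _ with s ≟ b
  ... | yes _ = a
  ... | no _ = s

  swap-left : ∀ a b → swap a b a ≡ b
  swap-left a b with a ≟ a
  ... | yes _ = refl
  ... | no n = ⊥-elim (n refl)

  swap-right : ∀ a b → swap a b b ≡ a
  swap-right a b with b ≟ a
  ... | yes e = e
  ... | no _ with b ≟ b
  ... | yes _ = refl
  ... | no n = ⊥-elim (n refl)

  swap-other : ∀ {a b s} → s ≢ a → s ≢ b → swap a b s ≡ s
  swap-other {a} {b} {s} na nb with s ≟ a
  ... | yes e = ⊥-elim (na e)
  ... | no _ with s ≟ b
  ... | yes e = ⊥-elim (nb e)
  ... | no _ = refl

  swap-view : ∀ a b s → (s ≡ a × swap a b s ≡ b) ⊎ (s ≡ b × swap a b s ≡ a) ⊎ (s ≢ a × s ≢ b × swap a b s ≡ s)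
  swap-view a b s with s ≟ a
  ... | yes e = inj₁ (e , refl)
  ... | no na with s ≟ b
  ... | yes e = inj₂ (inj₁ (e , refl))
  ... | no nb = inj₂ (inj₂ (na , nb , refl))

  swap-involutive : ∀ a b s → swap a b (swap a b s) ≡ s
  swap-involutive a b s with swap-view a b s
  ... | inj₁ (refl , e) = trans (cong (swap a b) e) (swap-right a b)
  ... | inj₂ (inj₁ (refl , e)) = trans (cong (swap a b) e) (swap-left a b)
  ... | inj₂ (inj₂ (_ , _ , e)) = trans (cong (swap a b) e) e

  transposition : ∀ {a b} → IsLiteral L a → IsLiteral L b → Renaming
  transposition {a} {b} p q = record { fn = swap a b ; arf = arf' ; fix = fix' }
    where
    arf' : ∀ s → ar (swap a b s) ≡ ar s
    arf' s with swap-view a b s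
    ... | inj₁ (refl , e) = trans (cong ar e) (trans q (≡-sym p))
    ... | inj₂ (inj₁ (refl , e)) = trans (cong ar e) (trans p (≡-sym q))
    ... | inj₂ (inj₂ (_ , _ , e)) = cong ar e
    fix' : ∀ s → ¬ IsLiteral L s → swap a b s ≡ s
    fix' s l = swap-other (λ { refl → l p }) (λ { refl → l q })

  -- Literals are treated one at a time, composing with the transposition that carries the present
  -- image of `a` back to `a`. Those treated before stay fixed: if one of them is `a`, the
  -- transposition is trivial; any other differs from `a` and, by injectivity, from the present
  -- image of `a`.
  invert-on : ∀ (ρ : Renaming) → Inj ρ → (l : List Sym) →
    ∃[ π ] (Inj π × (∀ s → s ∈ l → fn π (fn ρ s) ≡ s))
  invert-on ρ inj [] = identity , (λ e → e) , (λ s ())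
  invert-on ρ inj (a ∷ l) with invert-on ρ inj l
  ... | π , π-inj , inv with ar a Int.≟ + 0
  ... | no na = π , π-inj , λ { s (there m) → inv s m
                              ; s (here refl) → trans (cong (fn π) (fix ρ a na)) (fix π a na) }
  ... | yes p = compose τ π , (λ e → π-inj (swap-inj e)) ,
      λ { s (here refl) → swap-left b a ; s (there m) → trans (cong (swap b a) (inv s m)) (fixes s m) }
    where
    b : Sym
    b = fn π (fn ρ a)
    τ : Renaming
    τ = transposition (trans (arf π _) (trans (arf ρ a) p)) p
    swap-inj : ∀ {s s'} → swap b a s ≡ swap b a s' → s ≡ s'
    swap-inj e = trans (≡-sym (swap-involutive b a _)) (trans (cong (swap b a) e) (swap-involutive b a _))
    fixes : ∀ s → s ∈ l → swap b a s ≡ s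
    fixes s m with s ≟ a
    ... | yes refl = trans (swap-right b s) (inv s m)
    ... | no ne = swap-other (λ e → ne (inj (π-inj (trans (inv s m) e)))) ne

  ren-cancel : ∀ π ρ w → (∀ s → sym s ∈ w → fn π (fn ρ s) ≡ s) → ren π (ren ρ w) ≡ w
  ren-cancel π ρ [] h = refl
  ren-cancel π ρ (↓ ∷ w) h = cong (↓ ∷_) (ren-cancel π ρ w (λ s m → h s (there m)))
  ren-cancel π ρ (sym s ∷ w) h =
    cong₂ (λ a b → sym a ∷ b) (h s (here refl)) (ren-cancel π ρ w (λ s' m → h s' (there m)))

  -- Henkin theories

  -- Non-occurrence of the witness `c` in `ψ` makes the replacement of `v` by `c` injective on `ψ`,
  -- so that the renaming lemma applies to it in the truth lemma.
  record Henkin (Δ : W → Set) : Set where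
    field
      formula    : ∀ {φ} → Δ φ → Formula L φ
      closed     : ∀ {Γ φ} → (∀ x → x ∈ Γ → Δ x) → Formula L φ → Der Γ φ → Δ φ
      consistent : ∀ {φ} → Δ φ → ¬ Δ (negW L φ)
      complete   : ∀ {φ} → Formula L φ → ¬ Δ φ → Δ (negW L φ)
      witness    : ∀ {v ψ} → IsLiteral L v → Formula L ψ → Δ (sym v ∷ ψ) →
                   ∃[ c ] (IsLiteral L c × ¬ Occurs L c ψ × Δ (_[_/_] L ψ v c))

-- Lindenbaum extension with Henkin witnesses

module Lindenbaum (decide : (P : Set) → Dec P) (L : Language)
  (code : Word L → ℕ) (code-inj : ∀ {w w'} → code w ≡ code w' → w ≡ w')
  {v₀ : Language.Sym L} (p₀ : IsLiteral L v₀)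
  (Y : Word L → Set) (Y-formula : ∀ y → Y y → Formula L y)
  (Y-fresh : ∀ w → ∃[ c ] (IsLiteral L c × ¬ Occurs L c w × (∀ y → Y y → ¬ Occurs L c y)))
  where

  open Language L
  open FirstOrder L
  open Renaming

  private
    W : Set
    W = Word L

  -- Inconsistency of `Y` together with `l`. `Y` may be infinite, so a stage records only the finite
  -- list of formulas accepted so far.
  Inc : List W → Set
  Inc l = ∃[ Γ ] ((∀ x → x ∈ Γ → Y x ⊎ x ∈ l) × Der Γ (Bot v₀))

  remove : ∀ a (Γ : List W) → ∃[ Γ' ] (∀ x → (x ∈ Γ' → x ∈ Γ × x ≢ a) × (x ∈ Γ × x ≢ a → x ∈ Γ'))
  remove a [] = [] , λ x → (λ ()) , λ { (() , _) }
  remove a (b ∷ Γ) with remove a Γ | decide (b ≡ a)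
  ... | Γ' , h | yes refl = Γ' , λ x →
    (λ m → there (proj₁ (proj₁ (h x) m)) , proj₂ (proj₁ (h x) m)) ,
    (λ { (here e , ne) → ⊥-elim (ne e) ; (there m , ne) → proj₂ (h x) (m , ne) })
  ... | Γ' , h | no nb = b ∷ Γ' , λ x →
    (λ { (here refl) → here refl , nb ; (there m) → there (proj₁ (proj₁ (h x) m)) , proj₂ (proj₁ (h x) m) }) ,
    (λ { (here e , ne) → here e ; (there m , ne) → there (proj₂ (h x) (m , ne)) })

  Forms-∪ : ∀ {l} → Forms l → ∀ {Γ} → (∀ x → x ∈ Γ → Y x ⊎ x ∈ l) → Forms Γ
  Forms-∪ fs h x m = [ Y-formula x , fs x ]′ (h x m)

  -- `R∃←` with eigenvariable `c` trades the instance for the existential formula, which is already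
  -- in `l`; its side condition holds because `c` is absent from `Y`, `l` and `ψ`.
  witness-consistent : ∀ {l v c ψ} → Forms l → IsLiteral L v → Formula L ψ → IsLiteral L c →
    ¬ Occurs L c ψ → (∀ x → x ∈ l → ¬ Occurs L c x) → (∀ y → Y y → ¬ Occurs L c y) →
    sym v ∷ ψ ∈ l → Inc (_[_/_] L ψ v c ∷ l) → Inc l
  witness-consistent {l} {v} {c} {ψ} fs p d q cψ cl cY ex∈l (Γ , h , n , e)
    with split-list {P = λ x → Y x ⊎ x ∈ l} Γ
           (λ { x m → [ (λ y → inj₁ (inj₁ y)) , (λ { (here e) → inj₂ e ; (there m') → inj₁ (inj₂ m') }) ]′ (h x m) })
  -- The rule deletes every copy of the instance, and `Γ'` may still contain one when `v` does not
  -- occur in `ψ`.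
  ... | Γ' , h' , sub with remove (_[_/_] L ψ v c) Γ'
  ... | Γ₀ , h₀ = (sym v ∷ ψ) ∷ Γ₀ ,
      (λ { x (here refl) → inj₂ ex∈l ; x (there m) → h' x (proj₁ (proj₁ (h₀ x) m)) }) ,
      (suc (suc n) , exElim (Γ' , _[_/_] L ψ v c ∷ Γ' , ψ , v₀ , v , c , Forms-AllF (Forms-∪ fs h') , d ,
        p₀ , p , q ,
        weak (Forms-AllF (Forms-∷ Formula-ψ' (Forms-∪ fs h')) , Γ , e , sub) ,
        ≐-∷ _ Γ' ,
        (λ x m → [ cY x , cl x ]′ (h' x m)) , cψ ,
        (λ x → (λ { (here e) → inj₂ e ; (there m) → inj₁ (proj₁ (h₀ x) m) }) ,
               (λ { (inj₁ m) → there (proj₂ (h₀ x) m) ; (inj₂ e) → here e })) ,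
        refl))
    where
    Formula-ψ' : Formula L (_[_/_] L ψ v c)
    Formula-ψ' = subst (Formula L) (single-word p q ψ) (ren-Formula (single p q) d)

  Witnessed : List W → W → Set
  Witnessed l w = ∀ v ψ → w ≡ sym v ∷ ψ → IsLiteral L v → Formula L ψ →
    ∃[ c ] (IsLiteral L c × ¬ Occurs L c ψ × _[_/_] L ψ v c ∈ l)

  -- At most one word has code `n`, so a step treats a single formula. Rejection is measured against
  -- the old list `l`, acceptance against the new list `l'`.
  Step : List W → ℕ → Set
  Step l n = ∃[ l' ] ((∀ x → x ∈ l → x ∈ l') × Forms l' × ¬ Inc l' ×
    (∀ w → Formula L w → code w ≡ n → Inc (w ∷ l) ⊎ (w ∈ l' × Witnessed l' w)))

  step : ∀ l → Forms l → ¬ Inc l → ∀ n → Step l n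
  step l fs con n with decide (∃[ w ] (Formula L w × code w ≡ n × ¬ Inc (w ∷ l)))
  ... | no none = l , (λ x m → m) , fs , con , λ w d e → inj₁ (inconsistent w d e)
    where
    inconsistent : ∀ w → Formula L w → code w ≡ n → Inc (w ∷ l)
    inconsistent w d e with decide (Inc (w ∷ l))
    ... | yes i = i
    ... | no c = ⊥-elim (none (w , d , e , c))
  ... | yes (w , d , e , con') with decide (∃[ v ] ∃[ ψ ] (w ≡ sym v ∷ ψ × IsLiteral L v × Formula L ψ))
  ... | no none = w ∷ l , (λ x m → there m) , Forms-∷ d fs , con' , λ w' d' e' → inj₂ (added w' e')
    where
    added : ∀ w' → code w' ≡ n → w' ∈ w ∷ l × Witnessed (w ∷ l) w'
    added w' e' with code-inj {w'} {w} (trans e' (≡-sym e))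
    ... | refl = here refl , λ v ψ e p d → ⊥-elim (none (v , ψ , e , p , d))
  -- Drawn against the concatenation of the whole stage, the literal occurs in none of its formulas,
  -- in particular not in `ψ`.
  ... | yes (v , ψ , refl , p , dψ) with Y-fresh (concat (w ∷ l))
  ... | c , q , c∉ , cY = ψ' ∷ w ∷ l , (λ x m → there (there m)) ,
        Forms-∷ (subst (Formula L) (single-word p q ψ) (ren-Formula (single p q) dψ)) (Forms-∷ d fs) ,
        (λ i → con' (witness-consistent (Forms-∷ d fs) p dψ q cψ
          (λ x m o → c∉ (∈-concat⁺′ o m)) cY (here refl) i)) ,
        λ w' d' e' → inj₂ (added w' e')
    where
    ψ' : W
    ψ' = _[_/_] L ψ v c
    cψ : ¬ Occurs L c ψ
    cψ o = c∉ (∈-++⁺ˡ (there o))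
    added : ∀ w' → code w' ≡ n → w' ∈ ψ' ∷ w ∷ l × Witnessed (ψ' ∷ w ∷ l) w'
    added w' e' with code-inj {w'} {w} (trans e' (≡-sym e))
    ... | refl = there (here refl) , λ { v ψ refl p d → c , q , cψ , here refl }

  module _ (con₀ : ¬ Inc []) where

    Stage : Set
    Stage = Σ (List W) λ l → Forms l × ¬ Inc l

    next : (st : Stage) (n : ℕ) → Step (proj₁ st) n
    next (l , fs , con) n = step l fs con n

    stage : ℕ → Stage
    stage zero    = [] , (λ x ()) , con₀
    stage (suc n) = let (l' , _ , fs' , con' , _) = next (stage n) n in l' , fs' , con'

    elems : ℕ → List W
    elems n = proj₁ (stage n)

    elems-mono : ∀ k n x → x ∈ elems n → x ∈ elems (k + n)
    elems-mono zero n x m = m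
    elems-mono (suc k) n x m = proj₁ (proj₂ (next (stage (k + n)) (k + n))) x (elems-mono k n x m)

    Limit : W → Set
    Limit x = ∃[ n ] (x ∈ elems n)

    Limit-formula : ∀ {x} → Limit x → Formula L x
    Limit-formula {x} (n , m) = proj₁ (proj₂ (stage n)) x m

    bounded : ∀ Γ → (∀ x → x ∈ Γ → Limit x) → ∃[ n ] (∀ x → x ∈ Γ → x ∈ elems n)
    bounded [] h = 0 , (λ x ())
    bounded (a ∷ Γ) h with h a (here refl) | bounded Γ (λ x m → h x (there m))
    ... | k , m | n , sub = k + n ,
      λ { x (here refl) → subst (λ j → a ∈ elems j) (+-comm n k) (elems-mono n k a m)
        ; x (there m') → elems-mono k n x (sub x m') }

    Limit-con : ∀ {Γ} → (∀ x → x ∈ Γ → Limit x) → ¬ Der Γ (Bot v₀)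
    Limit-con {Γ} h d with bounded Γ h
    ... | n , sub = proj₂ (proj₂ (stage n)) (Γ , (λ x m → inj₂ (sub x m)) , d)

    at-code : ∀ w → Formula L w → Inc (w ∷ elems (code w)) ⊎ (Limit w × Witnessed (elems (suc (code w))) w)
    at-code w d with proj₂ (proj₂ (proj₂ (proj₂ (next (stage (code w)) (code w))))) w d refl
    ... | inj₁ i = inj₁ i
    ... | inj₂ (m , h) = inj₂ ((suc (code w) , m) , h)

    -- The stages start from the empty list, so `Y` is absorbed formula by formula: at its own stage
    -- `y` cannot be rejected, because adding it to `Y` changes nothing and the stage is consistent.
    Y⊆Limit : ∀ y → Y y → Limit y
    Y⊆Limit y yy with at-code y (Y-formula y yy)
    ... | inj₂ (m , _) = m
    ... | inj₁ (Γ , h , d) = ⊥-elim (proj₂ (proj₂ (stage (code y)))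
      (Γ , (λ x m → [ inj₁ , (λ { (here refl) → inj₁ yy ; (there m') → inj₂ m' }) ]′ (h x m)) , d))

    Limit-forms : ∀ {Γ} → (∀ x → x ∈ Γ → Limit x) → Forms Γ
    Limit-forms h x m = Limit-formula (h x m)

    -- A formula outside the limit was rejected at its own stage. Discharging `φ` in that refutation
    -- leaves only hypotheses from `Y` and from the stage, all of them in the limit.
    maximal : ∀ {φ} → Formula L φ → ¬ Limit φ → ∃[ Γ ] ((∀ x → x ∈ Γ → Limit x) × Der Γ (negW L φ))
    maximal {φ} d n with at-code φ d
    ... | inj₂ (m , _) = ⊥-elim (n m)
    ... | inj₁ (Γ , h , e) with split-list {P = Limit} Γ
      (λ x m → [ (λ y → inj₁ (Y⊆Limit x y)) , (λ { (here e) → inj₂ e ; (there m') → inj₁ (code φ , m') }) ]′ (h x m))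
    ... | Γ' , h' , sub = Γ' , h' ,
      Der-Bot p₀ (Forms-∷ d (Limit-forms h')) (Der-weaken (Forms-∷ d (Limit-forms h')) sub e)

    -- Otherwise the negation of `φ` follows from finitely many members of the limit and clashes
    -- with the given derivation.
    Limit-closed : ∀ {Γ φ} → (∀ x → x ∈ Γ → Limit x) → Formula L φ → Der Γ φ → Limit φ
    Limit-closed {Γ} {φ} h d e with decide (Limit φ)
    ... | yes m = m
    ... | no n with maximal d n
    ... | Γ' , h' , e' = ⊥-elim (Limit-con (λ x m → [ h x , h' x ]′ (∈-++⁻ Γ m))
      (Der-clash p₀ (Limit-forms h) (Limit-forms h') e e'))

    Limit-Henkin : Henkin Limit
    Limit-Henkin = record
      { formula = Limit-formula
      ; closed = Limit-closed
      ; consistent = λ {φ} m m' → Limit-con {φ ∷ negW L φ ∷ []}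
          (λ { x (here refl) → m ; x (there (here refl)) → m' })
          (Der-clash p₀ (one m) (one m') (Der-hyp (one m) (here refl)) (Der-hyp (one m') (here refl)))
      ; complete = λ d n → let (Γ , h , e) = maximal d n in Limit-closed h (nor d d) e
      ; witness = wit }
      where
      one : ∀ {φ} → Limit φ → Forms (φ ∷ [])
      one m = Forms-∷ (Limit-formula m) (λ x ())
      wit : ∀ {v ψ} → IsLiteral L v → Formula L ψ → Limit (sym v ∷ ψ) →
            ∃[ c ] (IsLiteral L c × ¬ Occurs L c ψ × Limit (_[_/_] L ψ v c))
      wit {v} {ψ} p d m with at-code (sym v ∷ ψ) (ex p d)
      ... | inj₂ (_ , h) = let (c , q , n , m') = h v ψ refl p d in c , q , n , suc (code (sym v ∷ ψ)) , m'
      -- Rejection at its own stage is impossible even if the formula entered elsewhere: the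
      -- refutation would use only members of the limit.
      ... | inj₁ (Γ , h , e) = ⊥-elim (Limit-con
        (λ x m' → [ Y⊆Limit x , (λ { (here refl) → m ; (there m'') → code (sym v ∷ ψ) , m'' }) ]′ (h x m')) e)

  extension : ¬ Inc [] → Σ (W → Set) λ Δ → Henkin Δ × (∀ y → Y y → Δ y)
  extension con = Limit con , Limit-Henkin con , Y⊆Limit con

-- Term model and truth lemma

module TermModel (decide : (P : Set) → Dec P) (L : Language)
  (code : Word L → ℕ) (code-inj : ∀ {w w'} → code w ≡ code w' → w ≡ w')
  {v₀ : Language.Sym L} (p₀ : IsLiteral L v₀)
  {Δ : Word L → Set} (H : FirstOrder.Henkin L Δ)
  where

  open Language L
  open FirstOrder L
  open Renaming
  open Henkin H

  private
    W : Set
    W = Word L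

  Δ-refl : ∀ {t} → Term L t → Δ (eqW L t t)
  Δ-refl d = closed (λ x ()) (Formula-eqW d d) (Der-refl d)

  Δ-sym : ∀ {t₁ t₂} → Term L t₁ → Term L t₂ → Δ (eqW L t₁ t₂) → Δ (eqW L t₂ t₁)
  Δ-sym d₁ d₂ m = closed (λ { x (here refl) → m }) (Formula-eqW d₂ d₁)
    (axiom (eqSym (_ , _ , d₁ , d₂ , ≐-one _ , refl)))

  Δ-trans : ∀ {t₁ t₂ t₃} → Term L t₁ → Term L t₂ → Term L t₃ →
    Δ (eqW L t₁ t₂) → Δ (eqW L t₂ t₃) → Δ (eqW L t₁ t₃)
  Δ-trans d₁ d₂ d₃ m m' = closed (λ { x (here refl) → m ; x (there (here refl)) → m' }) (Formula-eqW d₁ d₃)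
    (axiom (eqTrn (_ , _ , _ , d₁ , d₂ , d₃ , ≐-two _ _ , refl)))

  EqAll : ∀ {n} → Vec W n → Vec W n → Set
  EqAll ts ts' = ∀ j → Δ (eqW L (lookup ts j) (lookup ts' j))

  eqList : ∀ {n} → Vec W n → Vec W n → List W
  eqList ts ts' = tabulate (λ j → eqW L (lookup ts j) (lookup ts' j))

  ∈-eqList⁻ : ∀ {n} (ts ts' : Vec W n) {x} → x ∈ eqList ts ts' → ∃[ j ] (x ≡ eqW L (lookup ts j) (lookup ts' j))
  ∈-eqList⁻ ts ts' = ∈-tabulate⁻ {f = λ j → eqW L (lookup ts j) (lookup ts' j)}

  ∈-eqList⁺ : ∀ {n} (ts ts' : Vec W n) j → eqW L (lookup ts j) (lookup ts' j) ∈ eqList ts ts'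
  ∈-eqList⁺ ts ts' = ∈-tabulate⁺ {f = λ j → eqW L (lookup ts j) (lookup ts' j)}

  Δ-app : ∀ {s n} {ts ts' : Vec W (suc n)} → ar s ≡ + suc n → Terms L ts → Terms L ts' → EqAll ts ts' →
    Δ (eqW L (sym s ∷ concatV L ts) (sym s ∷ concatV L ts'))
  Δ-app {ts = ts} {ts'} p ds ds' e =
    closed {eqList ts ts'} (λ x m → let (j , e') = ∈-eqList⁻ ts ts' m in subst Δ (≡-sym e') (e j))
      (Formula-eqW (app p ds) (app p ds'))
      (axiom (congF (_ , _ , ts , ts' , p , ds , ds' ,
        (λ x → ∈-eqList⁻ ts ts' , λ { (j , refl) → ∈-eqList⁺ ts ts' j }) , refl)))

  Δ-rel : ∀ {r n} {ts ts' : Vec W (suc n)} → ar r ≡ -[1+ n ] → Terms L ts → Terms L ts' → EqAll ts ts' →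
    Δ (sym r ∷ concatV L ts) → Δ (sym r ∷ concatV L ts')
  Δ-rel {ts = ts} {ts'} p ds ds' e a =
    closed {_ ∷ eqList ts ts'}
      (λ { x (here refl) → a ; x (there m) → let (j , e') = ∈-eqList⁻ ts ts' m in subst Δ (≡-sym e') (e j) })
      (atom p ds')
      (axiom (congR (_ , _ , ts , ts' , p , ds , ds' ,
        (λ x → (λ { (here e) → inj₂ e ; (there m) → inj₁ (∈-eqList⁻ ts ts' m) }) ,
               (λ { (inj₁ (j , refl)) → there (∈-eqList⁺ ts ts' j) ; (inj₂ e) → here e })) , refl)))

  -- `R↓` keeps the inner two of four formulas: from ↓φφ and ↓ψψ it yields ↓φψ. The next two lemmas
  -- feed it ↓φψ twice, and then ↓φψ with ↓ψφ.
  Δ-nor⁺ : ∀ {φ ψ} → Formula L φ → Formula L ψ → ¬ Δ φ → ¬ Δ ψ → Δ (norW L φ ψ)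
  Δ-nor⁺ {φ} {ψ} d e n n' =
    closed (λ { x (here refl) → complete d n ; x (there (here refl)) → complete e n' }) (nor d e)
      (axiom (norR (φ , φ , ψ , ψ , d , d , e , e , ≐-two _ _ , refl)))

  Δ-nor-swap : ∀ {φ ψ} → Formula L φ → Formula L ψ → Δ (norW L φ ψ) → Δ (norW L ψ φ)
  Δ-nor-swap {φ} {ψ} d e m =
    closed (λ { x (here refl) → m ; x (there (here refl)) → m }) (nor e d)
      (axiom (norR (φ , ψ , φ , ψ , d , e , d , e , ≐-two _ _ , refl)))

  Δ-nor⁻ : ∀ {φ ψ} → Formula L φ → Formula L ψ → Δ (norW L φ ψ) → ¬ Δ ψ
  Δ-nor⁻ {φ} {ψ} d e m n = consistent n
    (closed (λ { x (here refl) → m ; x (there (here refl)) → Δ-nor-swap d e m }) (nor e e)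
      (axiom (norR (φ , ψ , ψ , φ , d , e , e , d , ≐-two _ _ , refl))))

  Δ-ex⁺ : ∀ {v t ψ χ} → IsLiteral L v → Term L t → Formula L ψ → TSub L v t ψ χ → Δ χ → Δ (sym v ∷ ψ)
  Δ-ex⁺ p td d s m = closed (λ { x (here refl) → m }) (ex p d)
    (axiom (exIntr (_ , _ , _ , _ , d , p , td , s , ≐-one _ , refl)))

  least : (P : ℕ → Set) → ∀ n → P n → ∃[ m ] (P m × (∀ k → P k → m ≤ k))
  least P n pn with search (suc n)
    where
    search : ∀ n → (∃[ m ] (P m × (∀ k → P k → m ≤ k))) ⊎ (∀ k → k < n → ¬ P k)
    search zero = inj₂ (λ k ())
    search (suc n) with search n
    ... | inj₁ r = inj₁ r
    ... | inj₂ none with decide (P n)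
    ... | yes pn = inj₁ (n , pn , λ k pk → ≮⇒≥ (λ lt → none k lt pk))
    ... | no ¬pn = inj₂ λ k lt pk → [ (λ lt' → none k lt' pk) , (λ { refl → ¬pn pk }) ]′ (m≤n⇒m<n∨m≡n (≤-pred lt))
  ... | inj₁ r = r
  ... | inj₂ none = ⊥-elim (none n ≤-refl pn)

  -- The universe consists of the terms of least code in their Δ-equality
  -- class; this replaces the quotient of the terms.
  Normal : W → Set
  Normal t = Term L t × (∀ t' → Term L t' → Δ (eqW L t t') → code t ≤ code t')

  -- The decided form `True` makes the membership proof irrelevant, so equality in `U` comes down to
  -- equality of words.
  U : Set
  U = Σ W λ t → True (decide (Normal t))

  normal : (u : U) → Normal (proj₁ u)
  normal (t , n) = toWitness n

  termU : (u : U) → Term L (proj₁ u)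
  termU u = proj₁ (normal u)

  -- Both codes are least in the same class, hence equal, and the coding is injective.
  U-≡ : (u u' : U) → Δ (eqW L (proj₁ u) (proj₁ u')) → u ≡ u'
  U-≡ u@(t , n) u'@(t' , n') m with code-inj {t} {t'} (≤-antisym
    (proj₂ (normal u) t' (termU u') m)
    (proj₂ (normal u') t (termU u) (Δ-sym (termU u) (termU u') m)))
  ... | refl = cong (t ,_) (T-irrelevant n n')

  normalise : ∀ {t} → Term L t → Σ U λ u → Δ (eqW L t (proj₁ u))
  normalise {t} d with least (λ n → ∃[ t' ] (Term L t' × Δ (eqW L t t') × code t' ≡ n)) (code t)
    (t , d , Δ-refl d , refl)
  ... | _ , (t' , d' , m , refl) , min =
    (t' , fromWitness (d' , λ t'' d'' m'' → min (code t'') (t'' , d'' , Δ-trans d d' d'' m m'' , refl))) , m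

  words : ∀ {n} → Vec U n → Vec W n
  words = Vec.map proj₁

  termsU : ∀ {n} (us : Vec U n) → Terms L (words us)
  termsU [] = []
  termsU (u ∷ us) = termU u ∷ termsU us

  -- At arity 0 the value is a literally constant function, since no
  -- function extensionality is available.
  den : ∀ s z → ar s ≡ z → Den L U z
  den s (+ zero)   p = λ _ → proj₁ (normalise (app p []))
  den s (+ suc n)  p = λ us → proj₁ (normalise (app p (termsU us)))
  den s (-[1+ n ]) p = λ us → ⌊ decide (Δ (sym s ∷ concatV L (words us))) ⌋

  u₀ : U
  u₀ = proj₁ (normalise (Term-lit p₀))

  open Sem u₀ public

  M : Str
  M s = den s (ar s) refl

  -- With the arity generalised to a variable `z`, matching on `p` removes the transport that
  -- `evalT` and `Sat` introduce.
  M-den : ∀ s {z} (p : ar s ≡ z) → subst (Den L U) p (M s) ≡ den s z p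
  M-den s refl = refl

  mutual
    -- `R₊` replaces the arguments by their values, and the head is interpreted by normalising the
    -- resulting term.
    eval-Δ : ∀ {t} (d : Term L t) → Δ (eqW L t (proj₁ (evalT L ⟨ M ⟩ d)))
    eval-Δ (app {s} {zero} p []) rewrite M-den s p = proj₂ (normalise (app p []))
    eval-Δ (app {s} {suc n} p {ts} ds) rewrite M-den s p =
      Δ-trans (app p ds) (app p ds') (termU (proj₁ (normalise (app p ds'))))
        (Δ-app p ds ds' (evals-Δ ds)) (proj₂ (normalise (app p ds')))
      where
      ds' : Terms L (words (evalTs L ⟨ M ⟩ ds))
      ds' = termsU (evalTs L ⟨ M ⟩ ds)

    evals-Δ : ∀ {n} {ts : Vec W n} (ds : Terms L ts) → EqAll ts (words (evalTs L ⟨ M ⟩ ds))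
    evals-Δ (d ∷ ds) Fin.zero = eval-Δ d
    evals-Δ (d ∷ ds) (Fin.suc j) = evals-Δ ds j

  EqAll-sym : ∀ {n} {ts ts' : Vec W n} → Terms L ts → Terms L ts' → EqAll ts ts' → EqAll ts' ts
  EqAll-sym (d ∷ ds) (d' ∷ ds') e Fin.zero = Δ-sym d d' (e Fin.zero)
  EqAll-sym (d ∷ ds) (d' ∷ ds') e (Fin.suc j) = EqAll-sym ds ds' (λ j → e (Fin.suc j)) j

  eval-≡⁺ : ∀ {t₁ t₂} (d₁ : Term L t₁) (d₂ : Term L t₂) → Δ (eqW L t₁ t₂) →
    evalT L ⟨ M ⟩ d₁ ≡ evalT L ⟨ M ⟩ d₂
  eval-≡⁺ d₁ d₂ m = U-≡ u₁ u₂ (Δ-trans (termU u₁) d₁ (termU u₂) (Δ-sym d₁ (termU u₁) (eval-Δ d₁))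
    (Δ-trans d₁ d₂ (termU u₂) m (eval-Δ d₂)))
    where
    u₁ u₂ : U
    u₁ = evalT L ⟨ M ⟩ d₁
    u₂ = evalT L ⟨ M ⟩ d₂

  eval-≡⁻ : ∀ {t₁ t₂} (d₁ : Term L t₁) (d₂ : Term L t₂) →
    evalT L ⟨ M ⟩ d₁ ≡ evalT L ⟨ M ⟩ d₂ → Δ (eqW L t₁ t₂)
  eval-≡⁻ {t₁} d₁ d₂ e = Δ-trans d₁ (termU u₂) d₂ (subst (λ u → Δ (eqW L t₁ (proj₁ u))) e (eval-Δ d₁))
    (Δ-sym d₂ (termU u₂) (eval-Δ d₂))
    where
    u₂ : U
    u₂ = evalT L ⟨ M ⟩ d₂

  -- For `eqs`, equality of values is equality in Δ. Any other relation is interpreted by membership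
  -- in Δ at the values, and `R𝓡` moves between the arguments and their values in both directions.
  truth-atom : ∀ {r n} (p : ar r ≡ -[1+ n ]) {ts : Vec W (suc n)} (ds : Terms L ts) →
    (Sat L ⟨ M ⟩ (atom p ds) → Δ (sym r ∷ concatV L ts)) ×
    (Δ (sym r ∷ concatV L ts) → Sat L ⟨ M ⟩ (atom p ds))
  truth-atom {r} p ds with r ≟ eqs
  truth-atom p ds | yes refl with -[1+-injective (trans (≡-sym p) ar-eqs)
  truth-atom p (_∷_ {t = t₁} d₁ (_∷_ {t = t₂} d₂ [])) | yes refl | refl =
    (λ e → subst Δ (≡-sym eq) (eval-≡⁻ d₁ d₂ e)) , (λ m → eval-≡⁺ d₁ d₂ (subst Δ eq m))
    where
    eq : sym eqs ∷ t₁ ++ t₂ ++ [] ≡ eqW L t₁ t₂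
    eq = cong (λ w → sym eqs ∷ t₁ ++ w) (++-identityʳ t₂)
  truth-atom {r} p ds | no _ rewrite M-den r p =
    (λ h → Δ-rel p ds' ds (EqAll-sym ds ds' (evals-Δ ds)) (toWitness h)) ,
    (λ m → fromWitness (Δ-rel p ds ds' (evals-Δ ds) m))
    where
    ds' : Terms L (words (evalTs L ⟨ M ⟩ ds))
    ds' = termsU (evalTs L ⟨ M ⟩ ds)

  -- Every element of the universe is named by a term, which turns a semantic witness into one
  -- usable in `R∃→`.
  eval-U : (u : U) → evalT L ⟨ M ⟩ (termU u) ≡ u
  eval-U u = ≡-sym (U-≡ u (evalT L ⟨ M ⟩ (termU u)) (eval-Δ (termU u)))

  witness-agree : ∀ {v c} (p : IsLiteral L v) (q : IsLiteral L c) w →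
    Agree (single p q) (upd M v p (proj₁ (normalise (app q [])))) M w
  witness-agree {v} {c} p q w s m with s ≟ v
  ... | no _ = refl
  ... | yes refl = ≡-sym (M-lit (≡-sym p))
    where
    M-lit : ∀ {z} (e : + 0 ≡ z) →
      subst (Den L U) (trans q e) (M c) ≡ subst (Den L U) e (λ _ → proj₁ (normalise (app q [])))
    -- At arity 0, `den` is definitionally the constant function on the right-hand side.
    M-lit refl = trans (cong (λ e → subst (Den L U) e (M c)) (uip (trans q refl) q)) (M-den c q)

  -- In the quantifier case, a semantic witness is replaced by the term naming it, and `R∃→` applies
  -- to the substituted formula. Conversely, the instance at the Henkin literal is true by
  -- induction, and the renaming lemma reads it as truth of the body with `v` assigned the value of
  -- that literal.
  truth : ∀ n {φ} → Depth≤ n φ → (Holds L ⟨ M ⟩ φ → Δ φ) × (Δ φ → Holds L ⟨ M ⟩ φ)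
  truth n (atom p ds) =
    (λ h → proj₁ (truth-atom p ds) (Holds-atom⁻ p ds h)) ,
    (λ m → atom p ds , proj₂ (truth-atom p ds) m)
  truth (suc n) (nor d e) =
    (λ h → let (x , y) = Holds-nor⁻ (Depth-Formula d) (Depth-Formula e) h in
      Δ-nor⁺ (Depth-Formula d) (Depth-Formula e)
        (λ m → x (proj₂ (truth n d) m)) (λ m → y (proj₂ (truth n e) m))) ,
    (λ m → Holds-nor⁺ (Depth-Formula d) (Depth-Formula e)
      (λ h → Δ-nor⁻ (Depth-Formula e) (Depth-Formula d)
               (Δ-nor-swap (Depth-Formula d) (Depth-Formula e) m) (proj₁ (truth n d) h))
      (λ h → Δ-nor⁻ (Depth-Formula d) (Depth-Formula e) m (proj₁ (truth n e) h)))
  truth (suc n) (ex {v = v} {φ} p d) = to , from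
    where
    to : Holds L ⟨ M ⟩ (sym v ∷ φ) → Δ (sym v ∷ φ)
    to h with Holds-ex⁻ p (Depth-Formula d) h
    ... | u , x with term-substitution u₀ p (termU u) d
    ... | χ , s , dχ , hχ = Δ-ex⁺ p (termU u) (Depth-Formula d) s (proj₁ (truth n dχ)
      (proj₂ (hχ M) (subst (λ u → Holds L ⟨ upd M v p u ⟩ φ) (≡-sym (eval-U u)) x)))
    from : Δ (sym v ∷ φ) → Holds L ⟨ M ⟩ (sym v ∷ φ)
    from m with witness p (Depth-Formula d) m
    ... | c , q , n∉ , m' = Holds-ex⁺ p (proj₂
      (Holds-ren (single p q) (Depth-Formula d) (single-inj p q n∉) (witness-agree p q φ))
      (proj₂ (truth n (ren-Depth (single p q) d)) (subst Δ (≡-sym (single-word p q φ)) m')))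

-- pair a m = 2 ^ a * (2 * m + 1)
pair : ℕ → ℕ → ℕ
pair zero    m = suc (2 * m)
pair (suc a) m = 2 * pair a m

pair-injective : ∀ a b {m n} → pair a m ≡ pair b n → a ≡ b × m ≡ n
pair-injective zero zero e = refl , *-cancelˡ-≡ _ _ 2 (suc-injective e)
pair-injective zero (suc b) {m} {n} e = ⊥-elim (even≢odd (pair b n) m (≡-sym e))
pair-injective (suc a) zero {m} {n} e = ⊥-elim (even≢odd (pair a m) n e)
pair-injective (suc a) (suc b) e with pair-injective a b (*-cancelˡ-≡ _ _ 2 e)
... | refl , e' = refl , e'

-- Leaves 0 free as the code of the empty word.
pair≢0 : ∀ a {m} → pair a m ≢ 0
pair≢0 zero ()
pair≢0 (suc a) e = pair≢0 a (*-cancelˡ-≡ _ 0 2 e)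

-- Injective coding of words by numbers

module Coding (L : Language) (f : Language.Sym L → ℕ) (f-inj : ∀ {s s'} → f s ≡ f s' → s ≡ s') where

  letter : Letter L → ℕ
  letter ↓       = 0
  letter (sym s) = suc (f s)

  letter-inj : ∀ {a b} → letter a ≡ letter b → a ≡ b
  letter-inj {↓} {↓} e = refl
  letter-inj {sym s} {sym s'} e = cong sym (f-inj (suc-injective e))

  code : Word L → ℕ
  code []      = 0
  code (a ∷ w) = pair (letter a) (code w)

  code-inj : ∀ {w w'} → code w ≡ code w' → w ≡ w'
  code-inj {[]} {[]} e = refl
  code-inj {[]} {b ∷ w'} e = ⊥-elim (pair≢0 (letter b) (≡-sym e))
  code-inj {a ∷ w} {[]} e = ⊥-elim (pair≢0 (letter a) e)
  code-inj {a ∷ w} {b ∷ w'} e with pair-injective (letter a) (letter b) e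
  ... | p , q = cong₂ _∷_ (letter-inj p) (code-inj q)

-- Freeing infinitely many literals

module Shift (decide : (P : Set) → Dec P) (L : Language)
  (f : Language.Sym L → ℕ) (f-inj : ∀ {s s'} → f s ≡ f s' → s ≡ s') where

  open Language L
  open FirstOrder L
  open Renaming

  earlier : ℕ → List Sym
  earlier zero    = []
  earlier (suc n) = proj₁ (lits-inf (earlier n)) ∷ earlier n

  lit : ℕ → Sym
  lit n = proj₁ (lits-inf (earlier n))

  lit-literal : ∀ n → IsLiteral L (lit n)
  lit-literal n = proj₁ (proj₂ (lits-inf (earlier n)))

  ∈-earlier : ∀ {m n} → m < n → lit m ∈ earlier n
  ∈-earlier {m} {suc n} lt with m≤n⇒m<n∨m≡n (≤-pred lt)
  ... | inj₁ lt' = there (∈-earlier lt')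
  ... | inj₂ refl = here refl

  lit-new : ∀ {m n} → m < n → lit m ≢ lit n
  lit-new {m} {n} lt e = proj₂ (proj₂ (lits-inf (earlier n))) (subst (_∈ earlier n) e (∈-earlier lt))

  lit-inj : ∀ {m n} → lit m ≡ lit n → m ≡ n
  lit-inj {m} {n} e with <-cmp m n
  ... | tri< lt _ _ = ⊥-elim (lit-new lt e)
  ... | tri≈ _ eq _ = eq
  ... | tri> _ _ gt = ⊥-elim (lit-new gt (≡-sym e))

  shift : Sym → Sym
  shift s with ar s Int.≟ + 0
  ... | yes _ = lit (2 * f s)
  ... | no _  = s

  σ : Renaming
  σ = record { fn = shift ; arf = arf' ; fix = fix' }
    where
    arf' : ∀ s → ar (shift s) ≡ ar s
    arf' s with ar s Int.≟ + 0
    ... | yes p = trans (lit-literal (2 * f s)) (≡-sym p)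
    ... | no _ = refl
    fix' : ∀ s → ¬ IsLiteral L s → shift s ≡ s
    fix' s n with ar s Int.≟ + 0
    ... | yes p = ⊥-elim (n p)
    ... | no _ = refl

  σ-inj : Inj σ
  σ-inj {s} {s'} e with ar s Int.≟ + 0 | ar s' Int.≟ + 0
  ... | yes _ | yes _ = f-inj (*-cancelˡ-≡ _ _ 2 (lit-inj e))
  ... | yes _ | no n = ⊥-elim (n (trans (cong ar (≡-sym e)) (lit-literal (2 * f s))))
  ... | no n | yes _ = ⊥-elim (n (trans (cong ar e) (lit-literal (2 * f s'))))
  ... | no _ | no _ = e

  odd-unused : ∀ k s → shift s ≢ lit (suc (2 * k))
  odd-unused k s e with ar s Int.≟ + 0
  ... | yes _ = even≢odd (f s) k (lit-inj e)
  ... | no n = n (trans (cong ar e) (lit-literal (suc (2 * k))))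

  odd-∉-ren : ∀ k w → ¬ Occurs L (lit (suc (2 * k))) (ren σ w)
  odd-∉-ren k w m with ∈-map⁻ (mapL shift) m
  ... | sym s , _ , e = odd-unused k s (≡-sym (sym-inj e))
    where
    sym-inj : ∀ {s s'} → _≡_ {A = Letter L} (sym s) (sym s') → s ≡ s'
    sym-inj refl = refl

  -- By injectivity of `lit` each entry of the list spoils at most one index, so a bound strictly
  -- above every spoiled index works; hence `suc j`.
  odd-escape : (l : List Sym) → ∃[ N ] (∀ k → N ≤ k → lit (suc (2 * k)) ∉ l)
  odd-escape [] = 0 , λ k _ ()
  odd-escape (a ∷ l) with odd-escape l | decide (∃[ k ] (lit (suc (2 * k)) ≡ a))
  ... | N , h | no none = N , λ { k le (here e) → none (k , e) ; k le (there m) → h k le m }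
  ... | N , h | yes (j , refl) = N ⊔ suc j ,
    λ { k le (here e) → 1+n≰n (subst (suc j ≤_)
            (*-cancelˡ-≡ k j 2 (suc-injective (lit-inj e))) (≤-trans (m≤n⊔m N (suc j)) le))
      ; k le (there m) → h k (≤-trans (m≤m⊔n N (suc j)) le) m }

-- Completeness by transport along the shift

module Completeness (decide : (P : Set) → Dec P) (L : Language)
  (f : Language.Sym L → ℕ) (f-inj : ∀ {s s'} → f s ≡ f s' → s ≡ s')
  (X : Word L → Set) (X-formula : ∀ x → X x → Formula L x)
  (φ : Word L) (φ-formula : Formula L φ)
  where

  open Language L
  open FirstOrder L
  open Renaming
  open Coding L f f-inj
  open Shift decide L f f-inj

  private
    W : Set
    W = Word L

  X¬φ : W → Set
  X¬φ z = X z ⊎ z ≡ negW L φ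

  Y : W → Set
  Y y = ∃[ z ] (X¬φ z × y ≡ ren σ z)

  X¬φ-formula : ∀ {z} → X¬φ z → Formula L z
  X¬φ-formula (inj₁ x) = X-formula _ x
  X¬φ-formula (inj₂ refl) = nor φ-formula φ-formula

  Y-formula : ∀ y → Y y → Formula L y
  Y-formula y (z , h , refl) = ren-Formula σ (X¬φ-formula h)

  Y-fresh : ∀ w → ∃[ c ] (IsLiteral L c × ¬ Occurs L c w × (∀ y → Y y → ¬ Occurs L c y))
  Y-fresh w with odd-escape (symbols w)
  ... | k , h = lit (suc (2 * k)) , lit-literal _ , (λ m → h k ≤-refl (∈-symbols m)) ,
    λ { y (z , _ , refl) → odd-∉-ren k z }

  v₀ : Sym
  v₀ = lit 0

  open Lindenbaum decide L code code-inj (lit-literal 0) Y Y-formula Y-fresh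

  preimage : ∀ Γ → (∀ y → y ∈ Γ → Y y) → ∃[ Γ₀ ] ((∀ z → z ∈ Γ₀ → X¬φ z) × Γ ≡ map (ren σ) Γ₀)
  preimage [] h = [] , (λ z ()) , refl
  preimage (y ∷ Γ) h with h y (here refl) | preimage Γ (λ y' m → h y' (there m))
  ... | z , hz , refl | Γ₀ , h₀ , refl = z ∷ Γ₀ , (λ { x (here refl) → hz ; x (there m) → h₀ x m }) , refl

  -- Applying `π` restores `Γ₀` and keeps the derivation valid, whatever other literals it mentions.
  -- The conclusion becomes `Bot` of another literal, still a falsum, so the negation of `φ` is
  -- discharged and `R¬¬` yields `φ`.
  unshift : ∀ {Γ₀ Γ₁} {v} (π : Renaming) → Inj π → IsLiteral L v →
    (∀ s → s ∈ symbols (concat Γ₀) → fn π (fn σ s) ≡ s) →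
    (∀ x → x ∈ Γ₁ → X x) → (∀ x → x ∈ Γ₀ → x ∈ negW L φ ∷ Γ₁) →
    Der (map (ren σ) Γ₀) (Bot v) → Der Γ₁ φ
  unshift {Γ₀} {Γ₁} {v} π π-inj p inv h₁ sub d =
    Der-dneg (Der-Bot (trans (arf π v) p) forms (Der-weaken forms (λ x m → sub x (cancel x m))
      (subst (Der (map (ren π) (map (ren σ) Γ₀))) r-Bot (Der-ren d))))
    where
    open Equivariance π π-inj
    cancel : ∀ x → x ∈ map (ren π) (map (ren σ) Γ₀) → x ∈ Γ₀
    cancel x m =
      let (y , m' , e) = ∈-map⁻ (ren π) m
          (z , m'' , e') = ∈-map⁻ (ren σ) m'
      in subst (_∈ Γ₀) (≡-sym (trans e (trans (cong (ren π) e')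
           (ren-cancel π σ z (λ s o → inv s (∈-symbols (∈-concat⁺′ o m'')))))) ) m''
    forms : Forms (negW L φ ∷ Γ₁)
    forms = Forms-∷ (nor φ-formula φ-formula) (λ x m → X-formula x (h₁ x m))
    r-Bot : ren π (Bot v) ≡ Bot (fn π v)
    r-Bot = trans (r-negW (eqW L [ sym v ] [ sym v ])) (cong (negW L) (ren-eqW π [ sym v ] [ sym v ]))

  Inc-derivable : Inc [] → _⊢[_]_ L X (D₁ L) φ
  Inc-derivable (Γ , h , d) =
    let (Γ₀ , h₀ , e) = preimage Γ (λ y m → [ (λ x → x) , (λ ()) ]′ (h y m))
        (π , π-inj , inv) = invert-on σ σ-inj (symbols (concat Γ₀))
        (Γ₁ , h₁ , sub) = split-list {P = X} Γ₀ h₀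
        (n , d') = unshift π π-inj (lit-literal 0) inv h₁ sub (subst (λ Γ → Der Γ (Bot v₀)) e d)
    in n , Γ₁ , h₁ , d'

  module _ {Δ : W → Set} (H : Henkin Δ) (Y⊆Δ : ∀ y → Y y → Δ y) where

    open Henkin H
    open TermModel decide L code code-inj (lit-literal 0) H

    -- The pullback of `M` along `σ`, so the hypothesis `Agree` of the renaming lemma holds by
    -- `refl`.
    M' : Str
    M' s = subst (Den L U) (arf σ s) (M (fn σ s))

    M'-σ : ∀ {z} → Formula L z →
      (Holds L ⟨ M' ⟩ z → Holds L ⟨ M ⟩ (ren σ z)) × (Holds L ⟨ M ⟩ (ren σ z) → Holds L ⟨ M' ⟩ z)
    M'-σ d = Holds-ren σ d (λ s s' _ _ e → σ-inj e) (λ s _ → refl)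

    M'-truth : ∀ {z} → Formula L z →
      (Holds L ⟨ M' ⟩ z → Δ (ren σ z)) × (Δ (ren σ z) → Holds L ⟨ M' ⟩ z)
    M'-truth d = let (to , from) = truth _ (proj₂ (Formula-Depth (ren-Formula σ d))) in
      (λ h → to (proj₁ (M'-σ d) h)) , (λ m → proj₂ (M'-σ d) (from m))

    -- `M'` satisfies `X` because Δ contains its shift. Truth of `φ` in `M'` would then put the
    -- shift of `φ` into Δ beside its negation, which `Y` contributes.
    refute : ¬ _⊨_ L X φ
    refute X⊨φ = consistent
      (proj₁ (M'-truth φ-formula) (X⊨φ ⟨ M' ⟩ λ x hx →
        proj₂ (M'-truth (X-formula x hx)) (Y⊆Δ (ren σ x) (x , inj₁ hx , refl))))
      (Y⊆Δ _ (negW L φ , inj₂ refl , ≡-sym (ren-norW σ φ φ)))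

  derivation : _⊨_ L X φ → _⊢[_]_ L X (D₁ L) φ
  derivation X⊨φ with decide (Inc [])
  ... | yes i = Inc-derivable i
  ... | no con = let (Δ , H , Y⊆Δ) = extension con in ⊥-elim (refute H Y⊆Δ X⊨φ)

mainTheorem1 : ((P : Set) → Dec P) →
    (L : Language) → Countable L →
    (X : Word L → Set) → (∀ x → X x → Formula L x) →
    (φ : Word L) → Formula L φ →
    _⊨_ L X φ → _⊢[_]_ L X (D₁ L) φ
mainTheorem1 decide L (f , f-inj) X X-formula φ φ-formula X⊨φ =
  Completeness.derivation decide L f f-inj X X-formula φ φ-formula X⊨φ
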